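{- Fix a finite field $\mathbb{F}_q$. For every integer $k\ge1$, there is a deterministic $n^{O(k)}$-time reduction from a Boolean QuadEq instance with $n$ variables over $\mathbb{F}_q$ to a linear subspace $\mathcal{L}\subseteq\mathbb{F}_q^{N\times N}$ with $N=n^{O(k)}$, such that: (YES) if the Boolean QuadEq instance is satisfiable, then $\mathcal{L}$ contains a nonzero matrix of rank $1$; (NO) if the Boolean QuadEq instance is unsatisfiable, then $\mathcal{L}$ contains no nonzero matrix of rank at most $k$.
   Context: A Boolean QuadEq instance over $\mathbb{F}_q$ consists of squarefree polynomials $f_1,\dots,f_m$ of degree at most $2$ over $\mathbb{F}_q$ in variables $x_1,\dots,x_n$; it is satisfiable if there is $a\in\{0,1\}^n\subseteq\mathbb{F}_q^n$ with $f_1(a)=\dots=f_m(a)=0$.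
   Formalization: The running time is bounded by (1+m)·n^{O(k)} for n ≥ 2, where m is the number of polynomials, since all of them must be read and m is not bounded in terms of n; this is n^{O(k)} whenever m = n^{O(k)}. -}

module Defs where

open import Level using (Level; _⊔_) renaming (suc to lsuc)
open import Algebra.Bundles using (CommutativeRing)
import Algebra.Properties.Semiring.Sum as SemiringSum
open import Data.Nat using (ℕ; zero; suc; _≡ᵇ_) renaming (_+_ to _+ℕ_; _∸_ to _∸ℕ_; _≤_ to _≤ℕ_)
open import Data.Bool using (if_then_else_)
open import Data.Fin using (Fin; toℕ) renaming (_≤_ to _≤F_)
open import Data.List using (List; []; _∷_; _++_; [_]; concat; tabulate)
open import Data.Product using (Σ; ∃; ∃-syntax; _×_; _,_)
open import Data.Sum using (_⊎_)
open import Data.Vec.Functional using (Vector)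
open import Function.Bundles using (Inverse)
open import Relation.Binary.PropositionalEquality as ≡ using (_≡_)
open import Relation.Nullary using (¬_)
open import Relation.Unary using (Pred)

record FiniteField (c ℓ : Level) : Set (lsuc (c ⊔ ℓ)) where
  field
    commutativeRing : CommutativeRing c ℓ
  open CommutativeRing commutativeRing public
  field
    0≉1         : ¬ (0# ≈ 1#)
    inverse     : ∀ x → ¬ (x ≈ 0#) → ∃[ y ] x * y ≈ 1#
    q           : ℕ
    enumeration : Inverse setoid (≡.setoid (Fin q))

  code : Carrier → ℕ
  code x = toℕ (Inverse.to enumeration x)

-- Random access machines: structured programs over registers and an indirectly addressed memory,
-- all holding natural numbers.  Each instruction and each test takes one
-- step.  There is no multiplication instruction, so that word lengths
-- grow by at most one bit per step and step counts agree, up to a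
-- polynomial, with Turing machine time.

Reg : Set
Reg = ℕ

data Instr : Set where
  set   : (dst : Reg) (v : ℕ) → Instr
  add   : (dst x y : Reg) → Instr
  sub   : (dst x y : Reg) → Instr       -- truncated subtraction
  load  : (dst addr : Reg) → Instr      -- dst ← memory[addr]
  store : (addr src : Reg) → Instr      -- memory[addr] ← src
  write : (src : Reg) → Instr           -- append src to the output tape

infixr 5 _⨾_

data Program : Set where
  skip   : Program
  instr  : Instr → Program
  _⨾_    : Program → Program → Program
  ifZero : Reg → Program → Program → Program
  while  : Reg → Program → Program      -- loop as long as the register is nonzero

record State : Set where
  constructor state
  field
    reg : ℕ → ℕ
    mem : ℕ → ℕ
    out : List ℕ
open State public

_[_≔_] : (ℕ → ℕ) → ℕ → ℕ → (ℕ → ℕ)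
(f [ a ≔ v ]) b = if b ≡ᵇ a then v else f b

exec : Instr → State → State
exec (set d v)    (state r m o) = state (r [ d ≔ v ]) m o
exec (add d x y)  (state r m o) = state (r [ d ≔ r x +ℕ r y ]) m o
exec (sub d x y)  (state r m o) = state (r [ d ≔ r x ∸ℕ r y ]) m o
exec (load d a)   (state r m o) = state (r [ d ≔ m (r a) ]) m o
exec (store a x)  (state r m o) = state r (m [ r a ≔ r x ]) o
exec (write x)    (state r m o) = state r m (o ++ [ r x ])

infix 4 ⟨_,_⟩⇓[_]_

-- ⟨ P , s ⟩⇓[ t ] s′ : started in s, the program P halts in s′ after t steps.
data ⟨_,_⟩⇓[_]_ : Program → State → ℕ → State → Set where
  ⇓-skip  : ∀ {s} → ⟨ skip , s ⟩⇓[ 1 ] s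
  ⇓-instr : ∀ {i s} → ⟨ instr i , s ⟩⇓[ 1 ] exec i s
  ⇓-seq   : ∀ {P Q s s′ s″ t u} →
            ⟨ P , s ⟩⇓[ t ] s′ → ⟨ Q , s′ ⟩⇓[ u ] s″ → ⟨ (P ⨾ Q) , s ⟩⇓[ t +ℕ u ] s″
  ⇓-if-0  : ∀ {x P Q s s′ t} → reg s x ≡ 0 →
            ⟨ P , s ⟩⇓[ t ] s′ → ⟨ ifZero x P Q , s ⟩⇓[ suc t ] s′
  ⇓-if-≢0 : ∀ {x P Q s s′ t} → ¬ (reg s x ≡ 0) →
            ⟨ Q , s ⟩⇓[ t ] s′ → ⟨ ifZero x P Q , s ⟩⇓[ suc t ] s′
  ⇓-stop  : ∀ {x P s} → reg s x ≡ 0 → ⟨ while x P , s ⟩⇓[ 1 ] s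
  ⇓-loop  : ∀ {x P s s′ s″ t u} → ¬ (reg s x ≡ 0) →
            ⟨ P , s ⟩⇓[ t ] s′ → ⟨ while x P , s′ ⟩⇓[ u ] s″ →
            ⟨ while x P , s ⟩⇓[ suc (t +ℕ u) ] s″

nth : List ℕ → ℕ → ℕ
nth []       _       = 0
nth (x ∷ _)  zero    = x
nth (_ ∷ xs) (suc i) = nth xs i

-- The input occupies an initial segment of the memory.
initial : List ℕ → State
initial input = state (λ _ → 0) (nth input) []

-- P , on the given input, halts after t steps having written exactly the
-- given output.
Computes : Program → (input output : List ℕ) (t : ℕ) → Set
Computes P input output t = ∃[ s ] ⟨ P , initial input ⟩⇓[ t ] s × out s ≡ output

module Over {c ℓ : Level} (F : FiniteField c ℓ) where

  open FiniteField F
  open SemiringSum semiring using (sum; sum-cong-≋; sum-replicate-zero; *-distribˡ-sum; ∑-distrib-+)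
  open import Relation.Binary.Reasoning.Setoid setoid
  open import Algebra.Properties.CommutativeSemigroup *-commutativeSemigroup using (x∙yz≈y∙xz)

  -- const + ∑ᵢ lin i · xᵢ + ∑ᵢⱼ quad i j · xᵢ xⱼ .  The last sum effectively
  -- ranges over i < j: this fixes one coefficient for each monomial and, as
  -- there is no xᵢ², makes the polynomial squarefree.
  record QuadPoly (n : ℕ) : Set (c ⊔ ℓ) where
    field
      const      : Carrier
      lin        : Fin n → Carrier
      quad       : Fin n → Fin n → Carrier
      squarefree : ∀ i j → j ≤F i → quad i j ≈ 0#
  open QuadPoly public

  eval : ∀ {n} → QuadPoly n → Vector Carrier n → Carrier
  eval f x = const f
           + sum (λ i → lin f i * x i)
           + sum (λ i → sum (λ j → quad f i j * (x i * x j)))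

  QuadEq : (n m : ℕ) → Set (c ⊔ ℓ)
  QuadEq n m = Fin m → QuadPoly n

  Boolean : ∀ {n} → Vector Carrier n → Set ℓ
  Boolean a = ∀ i → a i ≈ 0# ⊎ a i ≈ 1#

  Satisfiable : ∀ {n m} → QuadEq n m → Set (c ⊔ ℓ)
  Satisfiable f = ∃[ a ] Boolean a × (∀ s → eval (f s) a ≈ 0#)

  Matrix : ℕ → ℕ → Set c
  Matrix m n = Fin m → Fin n → Carrier

  Nonzero : ∀ {m n} → Matrix m n → Set ℓ
  Nonzero M = ¬ (∀ i j → M i j ≈ 0#)

  linComb : ∀ {r n} → Vector Carrier r → Vector (Vector Carrier n) r → Vector Carrier n
  linComb a v i = sum (λ s → a s * v s i)

  LinearlyIndependent : ∀ {r n} → Vector (Vector Carrier n) r → Set (c ⊔ ℓ)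
  LinearlyIndependent v = ∀ a → (∀ i → linComb a v i ≈ 0#) → ∀ s → a s ≈ 0#

  infix 4 _∈Span_

  _∈Span_ : ∀ {r n} → Vector Carrier n → Vector (Vector Carrier n) r → Set (c ⊔ ℓ)
  w ∈Span v = ∃[ a ] (∀ i → w i ≈ linComb a v i)

  columns : ∀ {m n} → Matrix m n → Vector (Vector Carrier m) n
  columns M j i = M i j

  -- The column space of M has a basis of r vectors.
  HasRank : ∀ {m n} → Matrix m n → ℕ → Set (c ⊔ ℓ)
  HasRank {m} M r = Σ (Vector (Vector Carrier m) r) λ v →
      LinearlyIndependent v
    × (∀ s → v s ∈Span columns M)
    × (∀ j → columns M j ∈Span v)

  record Subspace (N : ℕ) : Set (lsuc (c ⊔ ℓ)) where
    field
      Member   : Pred (Matrix N N) ℓ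
      resp     : ∀ {X Y} → (∀ i j → X i j ≈ Y i j) → Member X → Member Y
      0-closed : Member (λ _ _ → 0#)
      +-closed : ∀ {X Y} → Member X → Member Y → Member (λ i j → X i j + Y i j)
      *-closed : ∀ a {X} → Member X → Member (λ i j → a * X i j)

  infix 4 _∈ₛ_

  _∈ₛ_ : ∀ {N} → Matrix N N → Subspace N → Set ℓ
  X ∈ₛ L = Subspace.Member L X

  -- An algorithm outputs a subspace as a system of homogeneous linear
  -- equations  ∑ᵢⱼ A i j · X i j = 0 , one for each coefficient matrix A.
  record LinearSystem (N : ℕ) : Set c where
    field
      size  : ℕ
      coeff : Fin size → Matrix N N
  open LinearSystem public

  ⟪_,_⟫ : ∀ {N} → Matrix N N → Matrix N N → Carrier
  ⟪ A , X ⟫ = sum (λ i → sum (λ j → A i j * X i j))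

  private
    ⟪⟫-cong : ∀ {N} (A : Matrix N N) {X Y} → (∀ i j → X i j ≈ Y i j) → ⟪ A , X ⟫ ≈ ⟪ A , Y ⟫
    ⟪⟫-cong A X≈Y = sum-cong-≋ λ i → sum-cong-≋ λ j → *-congˡ (X≈Y i j)

    ⟪⟫-+ : ∀ {N} (A X Y : Matrix N N) →
           ⟪ A , (λ i j → X i j + Y i j) ⟫ ≈ ⟪ A , X ⟫ + ⟪ A , Y ⟫
    ⟪⟫-+ A X Y = begin
      sum (λ i → sum (λ j → A i j * (X i j + Y i j)))
        ≈⟨ sum-cong-≋ (λ i → sum-cong-≋ λ j → distribˡ (A i j) (X i j) (Y i j)) ⟩
      sum (λ i → sum (λ j → A i j * X i j + A i j * Y i j))
        ≈⟨ sum-cong-≋ (λ i → ∑-distrib-+ (λ j → A i j * X i j) (λ j → A i j * Y i j)) ⟩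
      sum (λ i → sum (λ j → A i j * X i j) + sum (λ j → A i j * Y i j))
        ≈⟨ ∑-distrib-+ (λ i → sum (λ j → A i j * X i j)) (λ i → sum (λ j → A i j * Y i j)) ⟩
      ⟪ A , X ⟫ + ⟪ A , Y ⟫ ∎

    ⟪⟫-* : ∀ {N} (A : Matrix N N) a (X : Matrix N N) →
           ⟪ A , (λ i j → a * X i j) ⟫ ≈ a * ⟪ A , X ⟫
    ⟪⟫-* A a X = begin
      sum (λ i → sum (λ j → A i j * (a * X i j)))
        ≈⟨ sum-cong-≋ (λ i → sum-cong-≋ λ j → x∙yz≈y∙xz (A i j) a (X i j)) ⟩
      sum (λ i → sum (λ j → a * (A i j * X i j)))
        ≈⟨ sum-cong-≋ (λ i → *-distribˡ-sum a (λ j → A i j * X i j)) ⟨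
      sum (λ i → a * sum (λ j → A i j * X i j))
        ≈⟨ *-distribˡ-sum a (λ i → sum (λ j → A i j * X i j)) ⟨
      a * ⟪ A , X ⟫ ∎

    ⟪⟫-0 : ∀ {N} (A : Matrix N N) → ⟪ A , (λ _ _ → 0#) ⟫ ≈ 0#
    ⟪⟫-0 {N} A = begin
      sum (λ i → sum (λ j → A i j * 0#))
        ≈⟨ sum-cong-≋ (λ i → trans (sum-cong-≋ λ j → zeroʳ (A i j)) (sum-replicate-zero N)) ⟩
      sum {N} (λ _ → 0#)
        ≈⟨ sum-replicate-zero N ⟩
      0# ∎

  solutionSpace : ∀ {N} → LinearSystem N → Subspace N
  solutionSpace E = record
    { Member   = λ X → ∀ e → ⟪ coeff E e , X ⟫ ≈ 0#
    ; resp     = λ X≈Y X∈ e → trans (sym (⟪⟫-cong (coeff E e) X≈Y)) (X∈ e)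
    ; 0-closed = λ e → ⟪⟫-0 (coeff E e)
    ; +-closed = λ {X} {Y} X∈ Y∈ e → trans (⟪⟫-+ (coeff E e) X Y)
                   (trans (+-cong (X∈ e) (Y∈ e)) (+-identityˡ 0#))
    ; *-closed = λ a {X} X∈ e → trans (⟪⟫-* (coeff E e) a X)
                   (trans (*-congˡ (X∈ e)) (zeroʳ a))
    }

  encodeVector : ∀ {n} → Vector Carrier n → List ℕ
  encodeVector v = tabulate (λ i → code (v i))

  encodeMatrix : ∀ {m n} → Matrix m n → List ℕ
  encodeMatrix M = concat (tabulate (λ i → encodeVector (M i)))

  encodePoly : ∀ {n} → QuadPoly n → List ℕ
  encodePoly f = code (const f) ∷ encodeVector (lin f) ++ encodeMatrix (quad f)

  encodeInstance : ∀ {n m} → QuadEq n m → List ℕ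
  encodeInstance {n} {m} f = n ∷ m ∷ concat (tabulate (λ s → encodePoly (f s)))

  encodeSystem : ∀ {N} → LinearSystem N → List ℕ
  encodeSystem {N} E = N ∷ size E ∷ concat (tabulate (λ e → encodeMatrix (coeff E e)))

module Submission where

-- Index the rows and columns of X by words of length D = 3k + 2 over the letters
-- 1, x₁, …, xₙ, and impose that the entry L (uv) at (u, v) depends only on the
-- product of the letters of uv modulo x² = x, and that L (f u) = 0 for every
-- equation f.  A Boolean solution gives the rank one matrix of its evaluations.
--
-- Conversely, let the instance be unsatisfiable and L (e) ≠ 0 for a product e of
-- literals.  Then some variable x splits e: both L (x y e) and L ((1 - x) z e)
-- are nonzero for suitable letters y and z, as otherwise L (p e) = p(a) L (e)
-- for a Boolean point a and all quadratic p, and a would be a solution.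
-- Splitting k times yields k + 1 pairwise orthogonal products e₀, …, eₖ with
-- L (eᵢ eᵢ) = L (eᵢ) ≠ 0 = L (eᵢ eⱼ), so X has rank greater than k.  This shows
-- that L vanishes on monomials of degree at most k.  A monomial of minimal
-- degree > k on which L does not vanish gives a scalar block of size k + 1.
--
-- The program is a nest of loops over the letters of the words, so that it only
-- compares letters and copies coefficients, and needs no arithmetic in the field.

open import Defs
open import Level using (Level; _⊔_)
open import Data.Nat using (ℕ; suc)

-- The degree bound `D` is what forces two cases in the lower bound. A product of literals can serve
-- as a row only within degree `D`, and each splitting adds two letters: quadratic monomials have to
-- be evaluated, and the value `L (x e)` does not control `L (x y e)`. So `k` splittings take `2k`
-- letters and leave room for a monomial of degree `k`. Longer monomials, up to degree `2D`, are out
-- of reach of splitting, but they have `k + 1` letters of which any one can be moved from the row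
-- to the column. The two ranges meet at `k`.
--
-- Rows and columns carry words and not monomials, so that `N = (n + 1) ^ D` is a plain power and
-- the program is one fixed loop nest for each `k`, with no normal form of monomials to compute. The
-- price is that commutativity and `x² = x` become linear equations between entries, and that short
-- monomials have to be padded with the letter for 1.

module Machine where

  open import Data.Bool using (Bool; true; false; if_then_else_; _∧_)
  open import Data.Nat
  open import Data.Nat.Properties
  open import Data.List using (List; []; _∷_; _++_; [_]; concat; tabulate)
  open import Data.List.Properties using (++-assoc; ++-identityʳ)
  open import Data.Product using (Σ; _,_; proj₁)
  open import Data.Vec as Vec using (Vec; []; _∷_)
  open import Data.Fin using (Fin; zero; suc; toℕ)
  open import Data.Nat.Tactic.RingSolver using (solve-∀)
  open import Data.Vec.Properties using (∷-injectiveˡ; ∷-injectiveʳ)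
  open import Relation.Nullary.Decidable using (dec-true; dec-false)
  open import Relation.Binary.PropositionalEquality hiding ([_])

  -- Programs with verified output and running time.

  ≔-same : ∀ (f : ℕ → ℕ) a {v} → (f [ a ≔ v ]) a ≡ v
  ≔-same f a {v} = cong (λ b → if b then v else f a) (dec-true (a ≟ a) refl)

  ≔-other : ∀ (f : ℕ → ℕ) {a b v} → b ≢ a → (f [ a ≔ v ]) b ≡ f b
  ≔-other f {a} {b} {v} b≢a = cong (λ c → if c then v else f b) (dec-false (b ≟ a) b≢a)

  -- All of the memory is covered, as no generated code stores: the input stays readable throughout
  -- the run.
  record Agree (h : ℕ) (s s′ : State) : Set where
    constructor agree
    field
      reg≡ : ∀ {r} → r < h → reg s′ r ≡ reg s r
      mem≡ : mem s′ ≡ mem s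
  open Agree

  agree-refl : ∀ {h s} → Agree h s s
  agree-refl = agree (λ _ → refl) refl

  agree-trans : ∀ {h s s′ s″} → Agree h s s′ → Agree h s′ s″ → Agree h s s″
  agree-trans p q = agree (λ r<h → trans (reg≡ q r<h) (reg≡ p r<h)) (trans (mem≡ q) (mem≡ p))

  agree-≤ : ∀ {h h′ s s′} → h ≤ h′ → Agree h′ s s′ → Agree h s s′
  agree-≤ h≤h′ p = agree (λ r<h → reg≡ p (<-≤-trans r<h h≤h′)) (mem≡ p)

  -- Registers are allocated like a stack: code generated at height h changes
  -- only the registers from h on.
  record Runs (h : ℕ) (P : Program) (T : ℕ) (o : List ℕ) (s : State) : Set where
    constructor runs
    field
      {final} : State
      {steps} : ℕ
      halts   : ⟨ P , s ⟩⇓[ steps ] final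
      steps≤  : steps ≤ T
      frame   : Agree h s final
      output  : out final ≡ out s ++ o
  open Runs

  runs-≤ : ∀ {h h′ P T T′ o s} → h′ ≤ h → T ≤ T′ → Runs h P T o s → Runs h′ P T′ o s
  runs-≤ h′≤h T≤T′ R = runs (halts R) (≤-trans (steps≤ R) T≤T′) (agree-≤ h′≤h (frame R)) (output R)

  runs-output : ∀ {h P T o o′ s} → o ≡ o′ → Runs h P T o s → Runs h P T o′ s
  runs-output {s = s} eq R = runs (halts R) (steps≤ R) (frame R) (trans (output R) (cong (out s ++_) eq))

  infixr 5 _⨾ᴿ_

  _⨾ᴿ_ : ∀ {h P Q T U o o′ s} (R : Runs h P T o s) → Runs h Q U o′ (final R) →
         Runs h (P ⨾ Q) (T + U) (o ++ o′) s
  _⨾ᴿ_ {o = o} {o′} {s} R S = runs (⇓-seq (halts R) (halts S)) (+-mono-≤ (steps≤ R) (steps≤ S))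
    (agree-trans (frame R) (frame S))
    (trans (output S) (trans (cong (_++ o′) (output R)) (++-assoc (out s) o o′)))

  skipᴿ : ∀ {h s} → Runs h skip 1 [] s
  skipᴿ {s = s} = runs ⇓-skip ≤-refl agree-refl (sym (++-identityʳ (out s)))

  private
    ≔-agree : ∀ {h d} (s : State) {v} → h ≤ d → Agree h s (state (reg s [ d ≔ v ]) (mem s) (out s))
    ≔-agree s h≤d = agree (λ r<h → ≔-other (reg s) (<⇒≢ (<-≤-trans r<h h≤d))) refl

  setᴿ : ∀ {h d v s} → h ≤ d → Runs h (instr (set d v)) 1 [] s
  setᴿ {s = s} h≤d = runs ⇓-instr ≤-refl (≔-agree s h≤d) (sym (++-identityʳ (out s)))

  addᴿ : ∀ {h d x y s} → h ≤ d → Runs h (instr (add d x y)) 1 [] s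
  addᴿ {s = s} h≤d = runs ⇓-instr ≤-refl (≔-agree s h≤d) (sym (++-identityʳ (out s)))

  subᴿ : ∀ {h d x y s} → h ≤ d → Runs h (instr (sub d x y)) 1 [] s
  subᴿ {s = s} h≤d = runs ⇓-instr ≤-refl (≔-agree s h≤d) (sym (++-identityʳ (out s)))

  loadᴿ : ∀ {h d x s} → h ≤ d → Runs h (instr (load d x)) 1 [] s
  loadᴿ {s = s} h≤d = runs ⇓-instr ≤-refl (≔-agree s h≤d) (sym (++-identityʳ (out s)))

  writeᴿ : ∀ {h x s} → Runs h (instr (write x)) 1 [ reg s x ] s
  writeᴿ = runs ⇓-instr ≤-refl (agree (λ _ → refl) refl) refl

  ifZeroᴿ : ∀ {h x P Q T o o′} s → Runs h P T o s → Runs h Q T o′ s →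
            Runs h (ifZero x P Q) (suc T) (if reg s x ≡ᵇ 0 then o else o′) s
  ifZeroᴿ {x = x} s R S with reg s x in eq
  ... | zero  = runs (⇓-if-0 eq (halts R)) (s≤s (steps≤ R)) (frame R) (output R)
  ... | suc v = runs (⇓-if-≢0 (λ z → 1+n≢0 (trans (sym eq) z)) (halts S)) (s≤s (steps≤ S)) (frame S) (output S)

  loop : Reg → Reg → Program → Program
  loop h step P = while (1 + h) (P ⨾ instr (add h h step) ⨾ instr (sub (1 + h) (1 + h) 1))

  -- The loop variable lives in register h, the remaining number of iterations in 1 + h.
  for : (h init step count : ℕ) → Program → Program
  for h init step count P = instr (set h init) ⨾ instr (add (1 + h) count 0) ⨾ loop h step P

  progression : (ℕ → List ℕ) → (step count start : ℕ) → List ℕ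
  progression g δ zero    v = []
  progression g δ (suc c) v = g v ++ progression g δ c (v + δ)

  -- These two registers make up for missing instructions: adding register 0 copies a register, and
  -- register 1 is the amount by which loop counters decrease and letters increase.
  record Constants (s : State) : Set where
    constructor constants
    field
      zero≡ : reg s 0 ≡ 0
      one≡  : reg s 1 ≡ 1
  open Constants

  constants-agree : ∀ {h s s′} → 2 ≤ h → Agree h s s′ → Constants s → Constants s′
  constants-agree 2≤h p c = constants (trans (reg≡ p (≤-trans (s≤s z≤n) 2≤h)) (zero≡ c))
                                      (trans (reg≡ p 2≤h) (one≡ c))

  -- The output of the body is a function of the loop variable alone, for every state that agrees
  -- with `s₀` below `h`. Therefore no invariant besides `Agree h s₀` has to be carried along. The 3
  -- extra steps per round are the test, the increment and the decrement.
  loopᴿ : ∀ {h step P T δ} {g : ℕ → List ℕ} s₀ → 2 ≤ h → step < h →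
          Constants s₀ → reg s₀ step ≡ δ →
          (∀ s → Agree h s₀ s → Runs (2 + h) P T (g (reg s h)) s) →
          ∀ c v s → Agree h s₀ s → reg s h ≡ v → reg s (1 + h) ≡ c →
          Σ (Runs h (loop h step P) (c * (T + 3) + 1) (progression g δ c v) s) λ R →
            reg (final R) h ≡ v + c * δ
  loopᴿ {h} s₀ 2≤h step<h ok δ≡ body zero v s s~ v≡ c≡ =
    runs (⇓-stop c≡) ≤-refl agree-refl (sym (++-identityʳ (out s))) , trans v≡ (sym (+-identityʳ v))
  loopᴿ {h} {step} {P} {T} {δ} {g} s₀ 2≤h step<h ok δ≡ body (suc c) v s s~ v≡ c≡ =
    let R  = body s s~
        R₁ = runs-≤ (m≤n+m h 2) ≤-refl R
        S  = R₁ ⨾ᴿ addᴿ {d = h} {x = h} {y = step} ≤-refl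
               ⨾ᴿ subᴿ {d = 1 + h} {x = 1 + h} {y = 1} (n≤1+n h)
        ρ  = reg (final R)
        f₁ = agree-trans s~ (frame R₁)
        ρ₁ = ρ [ h ≔ ρ h + ρ step ]
        v′ : reg (final S) h ≡ v + δ
        v′ = trans (≔-other ρ₁ {a = 1 + h} {b = h} (<⇒≢ (n<1+n h)))
             (trans (≔-same ρ h)
             (cong₂ _+_ (trans (reg≡ (frame R) (s≤s (n≤1+n h))) v≡)
                        (trans (reg≡ f₁ step<h) δ≡)))
        c′ : reg (final S) (1 + h) ≡ c
        c′ = trans (≔-same ρ₁ (1 + h))
             (cong₂ _∸_ (trans (≔-other ρ (λ e → <⇒≢ (n<1+n h) (sym e)))
                               (trans (reg≡ (frame R) ≤-refl) c≡))
                        (trans (≔-other ρ (<⇒≢ 2≤h)) (trans (reg≡ f₁ 2≤h) (one≡ ok))))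
        (L , v″) = loopᴿ {g = g} s₀ 2≤h step<h ok δ≡ body c (v + δ) (final S)
                     (agree-trans s~ (frame S)) v′ c′
    in runs (⇓-loop (λ z → 1+n≢0 (trans (sym c≡) z)) (halts S) (halts L))
         (≤-trans (s≤s (+-mono-≤ (steps≤ S) (steps≤ L))) (≤-reflexive (time T)))
         (agree-trans (frame S) (frame L))
         (trans (output L) (trans (cong (_++ progression g δ c (v + δ)) (output S))
           (trans (++-assoc (out s) _ _)
             (cong (out s ++_) (cong₂ _++_ (trans (++-identityʳ _) (cong g v≡)) refl)))))
       , trans v″ (+-assoc v δ (c * δ))
    where
      time : ∀ T → suc (T + 2 + (c * (T + 3) + 1)) ≡ T + 3 + c * (T + 3) + 1
      time T = begin
        suc (T + 2 + (c * (T + 3) + 1)) ≡⟨ +-assoc (suc (T + 2)) (c * (T + 3)) 1 ⟨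
        suc (T + 2) + c * (T + 3) + 1   ≡⟨ cong (λ z → z + c * (T + 3) + 1) (+-suc T 2) ⟨
        T + 3 + c * (T + 3) + 1 ∎
        where open ≡-Reasoning

  forᴿ : ∀ {h init step count P T δ c} {g : ℕ → List ℕ} s → 2 ≤ h → step < h → count < h →
         Constants s → reg s step ≡ δ → reg s count ≡ c →
         (∀ s′ → Agree h s s′ → Runs (2 + h) P T (g (reg s′ h)) s′) →
         Σ (Runs h (for h init step count P) (c * (T + 3) + 3) (progression g δ c init) s) λ R →
           reg (final R) h ≡ init + c * δ
  forᴿ {h} {init} {step} {count} {P} {T} {δ} {c} {g} s 2≤h step<h count<h ok δ≡ c≡ body =
    let S₁ = setᴿ {h} {h} {init} {s} ≤-refl
        S₂ = addᴿ {h} {1 + h} {count} {0} {final S₁} (n≤1+n h)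
        ρ₁ = reg (final S₁)
        v≡ : reg (final S₂) h ≡ init
        v≡ = trans (≔-other ρ₁ (<⇒≢ (n<1+n h))) (≔-same (reg s) h)
        c′ : reg (final S₂) (1 + h) ≡ c
        c′ = trans (≔-same ρ₁ (1 + h))
               (trans (cong₂ _+_ (trans (≔-other (reg s) (<⇒≢ count<h)) c≡)
                                 (trans (≔-other (reg s) (<⇒≢ (≤-trans (s≤s z≤n) 2≤h))) (zero≡ ok)))
                      (+-identityʳ c))
        (L , v″) = loopᴿ {g = g} s 2≤h step<h ok δ≡ body c init (final S₂)
                     (agree-trans (frame S₁) (frame S₂)) v≡ c′
    in runs-≤ ≤-refl (≤-reflexive (trans (sym (+-suc 1 _)) (trans (+-comm 2 _) (+-assoc (c * (T + 3)) 1 2))))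
         (S₁ ⨾ᴿ S₂ ⨾ᴿ L)
       , v″

  -- Register 1 holds the step 1 and register 3 the alphabet size `n + 1`. Each level takes two
  -- registers, a letter and its counter, so the letters sit in every other register from `h` on.
  nest : (d h : ℕ) → Program → Program
  nest zero    h P = P
  nest (suc d) h P = for h 0 1 3 (nest d (2 + h) P)

  top : (d h : ℕ) → ℕ
  top zero    h = h
  top (suc d) h = top d (2 + h)

  ≤-top : ∀ d h → h ≤ top d h
  ≤-top zero    h = ≤-refl
  ≤-top (suc d) h = ≤-trans (m≤n+m h 2) (≤-top d (2 + h))

  digitRegs : ∀ d → ℕ → Vec Reg d
  digitRegs zero    h = []
  digitRegs (suc d) h = h ∷ digitRegs d (2 + h)

  digitRegs-agree : ∀ d h {s s′} → Agree (top d h) s s′ →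
                    Vec.map (reg s′) (digitRegs d h) ≡ Vec.map (reg s) (digitRegs d h)
  digitRegs-agree zero    h p = refl
  digitRegs-agree (suc d) h p =
    cong₂ _∷_ (reg≡ p (≤-trans (n≤1+n (suc h)) (≤-top d (2 + h)))) (digitRegs-agree d (2 + h) p)

  nestOut : ∀ (B d : ℕ) → (Vec ℕ d → List ℕ) → List ℕ
  nestOut B zero    g = g []
  nestOut B (suc d) g = progression (λ x → nestOut B d (λ w → g (x ∷ w))) 1 B 0

  nestTime : (B d T : ℕ) → ℕ
  nestTime B zero    T = T
  nestTime B (suc d) T = B * (nestTime B d T + 3) + 3

  nestᴿ : ∀ d h {B T P} s (g : Vec ℕ d → List ℕ) → 4 ≤ h → Constants s → reg s 3 ≡ B →
          (∀ s′ → Agree h s s′ → Runs (top d h) P T (g (Vec.map (reg s′) (digitRegs d h))) s′) →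
          Runs h (nest d h P) (nestTime B d T) (nestOut B d g) s
  nestᴿ zero    h s g 4≤h ok B≡ body = body s agree-refl
  nestᴿ (suc d) h s g 4≤h ok B≡ body =
    proj₁ (forᴿ s 2≤h 2≤h 4≤h ok (one≡ ok) B≡ λ s₁ p₁ →
      nestᴿ d (2 + h) s₁ (λ w → g (reg s₁ h ∷ w)) (m≤n⇒m≤o+n 2 4≤h) (constants-agree 2≤h p₁ ok)
        (trans (reg≡ p₁ 4≤h) B≡) λ s₂ p₂ →
          runs-output (cong (λ x → g (x ∷ _)) (reg≡ p₂ (n≤1+n (suc h))))
            (body s₂ (agree-trans p₁ (agree-≤ (m≤n+m h 2) p₂))))
    where 2≤h = ≤-trans (s≤s (s≤s z≤n)) 4≤h

  progression-[] : ∀ δ c v → progression (λ _ → []) δ c v ≡ []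
  progression-[] δ zero    v = refl
  progression-[] δ (suc c) v = progression-[] δ c (v + δ)

  -- Stands in for the multiplication that the machine does not have: an empty loop leaves the
  -- product, added to `init`, in its loop variable.
  multiply : (h init step count : ℕ) → Program
  multiply h init step count = for h init step count skip

  multiplyᴿ : ∀ {h init step count δ c} s → 2 ≤ h → step < h → count < h →
              Constants s → reg s step ≡ δ → reg s count ≡ c →
              Σ (Runs h (multiply h init step count) (c * 4 + 3) [] s) λ R →
                reg (final R) h ≡ init + c * δ
  multiplyᴿ {init = init} {δ = δ} {c} s 2≤h step<h count<h ok δ≡ c≡
    with forᴿ {g = λ _ → []} s 2≤h step<h count<h ok δ≡ c≡ (λ _ _ → skipᴿ)
  ... | R , v≡ = runs-output (progression-[] δ c init) R , v≡

  -- Each product counts up to `B` and steps by the growing power, not the other way round. This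
  -- keeps the time linear in `d * B`, although the result is of size `B ^ d`.
  power : (d x : ℕ) → Program
  power zero    x = skip
  power (suc d) x = multiply (1 + x) 0 x 3 ⨾ instr (add x (1 + x) 0) ⨾ power d x

  powerᴿ : ∀ d x {B} s → 4 ≤ x → Constants s → reg s 3 ≡ B →
           Σ (Runs x (power d x) (d * (B * 4 + 4) + 1) [] s) λ R →
             reg (final R) x ≡ B ^ d * reg s x
  powerᴿ zero    x s 4≤x ok B≡ = skipᴿ , sym (+-identityʳ (reg s x))
  powerᴿ (suc d) x {B} s 4≤x ok B≡ =
    let 2≤x = ≤-trans (s≤s (s≤s z≤n)) 4≤x
        (R₀ , v≡) = multiplyᴿ {1 + x} {0} s (m≤n⇒m≤1+n 2≤x) ≤-refl (m≤n⇒m≤1+n 4≤x) ok refl B≡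
        R₁ = runs-≤ (n≤1+n x) ≤-refl R₀
        R₂ = R₁ ⨾ᴿ addᴿ {x} {x} {1 + x} {0} ≤-refl
        f₂ = frame R₂
        v₂ : reg (final R₂) x ≡ B * reg s x
        v₂ = trans (≔-same (reg (final R₁)) x)
               (trans (cong₂ _+_ v≡ (trans (reg≡ (frame R₁) (≤-trans (s≤s z≤n) 4≤x)) (zero≡ ok)))
                      (+-identityʳ (B * reg s x)))
        (R₃ , v₃) = powerᴿ d x (final R₂) 4≤x (constants-agree 2≤x f₂ ok) (trans (reg≡ f₂ 4≤x) B≡)
    in runs-≤ ≤-refl (≤-reflexive (time d B))
         (R₁ ⨾ᴿ addᴿ {x} {x} {1 + x} {0} ≤-refl ⨾ᴿ R₃)
       , trans v₃ (trans (cong (B ^ d *_) v₂) (trans (sym (*-assoc (B ^ d) B (reg s x)))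
           (cong (_* reg s x) (*-comm (B ^ d) B))))
    where
      time : ∀ d B → B * 4 + 3 + (1 + (d * (B * 4 + 4) + 1)) ≡ B * 4 + 4 + d * (B * 4 + 4) + 1
      time = solve-∀

  -- Comparing words and writing coefficients.

  eqs : ∀ {m} → Vec ℕ m → Vec ℕ m → Bool
  eqs []       []       = true
  eqs (x ∷ xs) (y ∷ ys) = (x ≡ᵇ y) ∧ eqs xs ys

  -- Of the two truncated differences one is zero and the other is the distance, so a single zero
  -- test of their sum decides equality.
  distance-≡ᵇ : ∀ x y → ((x ∸ y) + (y ∸ x) ≡ᵇ 0) ≡ (x ≡ᵇ y)
  distance-≡ᵇ zero    zero    = refl
  distance-≡ᵇ zero    (suc y) = refl
  distance-≡ᵇ (suc x) zero    = refl
  distance-≡ᵇ (suc x) (suc y) = distance-≡ᵇ x y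

  if-∧ : ∀ {A : Set} a b {x y : A} → (if a then (if b then x else y) else y) ≡ (if a ∧ b then x else y)
  if-∧ true  b = refl
  if-∧ false b = refl

  ifEqs : ∀ {m} → ℕ → Vec Reg m → Vec Reg m → Program → Program → Program
  ifEqs h []       []       P Q = P
  ifEqs h (x ∷ xs) (y ∷ ys) P Q =
    instr (sub h x y) ⨾ instr (sub (1 + h) y x) ⨾ instr (add h h (1 + h)) ⨾
    ifZero h (ifEqs h xs ys P Q) Q

  -- A semantic form of "these registers lie below `h`". It passes through `lhs` and `rhs` by
  -- naturality, without a study of which registers these select.
  Stable : ∀ {m} → ℕ → Vec Reg m → Set
  Stable h xs = ∀ {s s′} → Agree h s s′ → Vec.map (reg s′) xs ≡ Vec.map (reg s) xs

  ifEqsᴿ : ∀ {h m P Q T oP oQ} (xs ys : Vec Reg m) s → Stable h xs → Stable h ys →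
           (∀ s′ → Agree h s s′ → Runs h P T oP s′) →
           (∀ s′ → Agree h s s′ → Runs h Q T oQ s′) →
           Runs h (ifEqs h xs ys P Q) (m * 4 + T)
             (if eqs (Vec.map (reg s) xs) (Vec.map (reg s) ys) then oP else oQ) s
  ifEqsᴿ []       []       s sx sy P Q = P s agree-refl
  ifEqsᴿ {h} {suc m} {T = T} {oP} {oQ} (x ∷ xs) (y ∷ ys) s sx sy P Q =
    let R₁ = subᴿ {h} {h} {x} {y} {s} ≤-refl
        R₂ = subᴿ {h} {1 + h} {y} {x} {final R₁} (n≤1+n h)
        R₃ = addᴿ {h} {h} {h} {1 + h} {final R₂} ≤-refl
        ρ  = reg s
        ρ₁ = reg (final R₁)
        s₃ = final R₃
        f  = frame (R₁ ⨾ᴿ R₂ ⨾ᴿ R₃)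
        v₁ : reg (final R₂) h ≡ ρ x ∸ ρ y
        v₁ = trans (≔-other ρ₁ (<⇒≢ (n<1+n h))) (≔-same ρ h)
        v₂ : reg (final R₂) (1 + h) ≡ ρ y ∸ ρ x
        v₂ = trans (≔-same ρ₁ (1 + h)) (cong₂ _∸_ (∷-injectiveˡ (sy (frame R₁))) (∷-injectiveˡ (sx (frame R₁))))
        v₃ : (reg s₃ h ≡ᵇ 0) ≡ (ρ x ≡ᵇ ρ y)
        v₃ = trans (cong (_≡ᵇ 0) (trans (≔-same (reg (final R₂)) h) (cong₂ _+_ v₁ v₂)))
                   (distance-≡ᵇ (ρ x) (ρ y))
        rest = ifEqsᴿ xs ys s₃ (λ p → ∷-injectiveʳ (sx p)) (λ p → ∷-injectiveʳ (sy p))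
                 (λ s′ p → P s′ (agree-trans f p)) (λ s′ p → Q s′ (agree-trans f p))
        R₄ = ifZeroᴿ s₃ rest (runs-≤ ≤-refl (m≤n+m T (m * 4)) (Q s₃ f))
    in runs-output
         (trans (cong₂ (λ b e → if b then (if e then oP else oQ) else oQ) v₃
                  (cong₂ eqs (∷-injectiveʳ (sx f)) (∷-injectiveʳ (sy f))))
                (if-∧ (ρ x ≡ᵇ ρ y) (eqs (Vec.map ρ xs) (Vec.map ρ ys))))
         (R₁ ⨾ᴿ R₂ ⨾ᴿ R₃ ⨾ᴿ R₄)

  emit : ℕ → ℕ → Program
  emit h v = instr (set h v) ⨾ instr (write h)

  emitᴿ : ∀ {h v s} → Runs h (emit h v) 2 [ v ] s
  emitᴿ {h} {v} {s} = runs-output (cong [_] (≔-same (reg s) h)) (setᴿ ≤-refl ⨾ᴿ writeᴿ {h} {h})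

  swapAt : ∀ {A : Set} {m} → ℕ → Vec A m → Vec A m
  swapAt zero    (a ∷ b ∷ w) = b ∷ a ∷ w
  swapAt zero    w           = w
  swapAt (suc p) []          = []
  swapAt (suc p) (a ∷ w)     = a ∷ swapAt p w

  -- The two sides of the equations between entries: a repeated letter may be
  -- replaced by o (the constant 1), and adjacent letters may be swapped.
  lhs rhs : ∀ {A : Set} {t m} → Fin (suc t) → A → Vec A m → Vec A m
  lhs zero    o (a ∷ b ∷ w) = a ∷ a ∷ w
  lhs zero    o w           = w
  lhs (suc p) o w           = w
  rhs zero    o (a ∷ b ∷ w) = a ∷ o ∷ w
  rhs zero    o w           = w
  rhs (suc p) o w           = swapAt (toℕ p) w

  map-swapAt : ∀ {A B : Set} {m} (f : A → B) p (w : Vec A m) → Vec.map f (swapAt p w) ≡ swapAt p (Vec.map f w)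
  map-swapAt f zero    []          = refl
  map-swapAt f zero    (a ∷ [])    = refl
  map-swapAt f zero    (a ∷ b ∷ w) = refl
  map-swapAt f (suc p) []          = refl
  map-swapAt f (suc p) (a ∷ w)     = cong (f a ∷_) (map-swapAt f p w)

  module _ {A B : Set} {t m : ℕ} (f : A → B) (o : A) where

    -- Naturality lets both sides of an equation be formed from register names when the program is
    -- built: reading the rearranged registers gives the rearranged word. With `toℕ` for `f` it also
    -- relates words over `Fin` to the words of numbers in the output.
    map-lhs : (k : Fin (suc t)) (w : Vec A m) → Vec.map f (lhs k o w) ≡ lhs k (f o) (Vec.map f w)
    map-lhs zero    []          = refl
    map-lhs zero    (a ∷ [])    = refl
    map-lhs zero    (a ∷ b ∷ w) = refl
    map-lhs (suc p) w           = refl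

    map-rhs : (k : Fin (suc t)) (w : Vec A m) → Vec.map f (rhs k o w) ≡ rhs k (f o) (Vec.map f w)
    map-rhs zero    []          = refl
    map-rhs zero    (a ∷ [])    = refl
    map-rhs zero    (a ∷ b ∷ w) = refl
    map-rhs (suc p) w           = map-swapAt f (toℕ p) w

  module _ (z p q : ℕ) where

    -- With `z`, `p`, `q` the codes of 0, 1 and -1, this is the coefficient of the entry `w` in the
    -- equation `L u - L v = 0`. If `u` and `v` coincide, the two terms cancel, whence the `z` in
    -- the first case.
    signOut : ∀ {m} → Vec ℕ m → Vec ℕ m → Vec ℕ m → List ℕ
    signOut u v w = if eqs w u then (if eqs w v then [ z ] else [ p ]) else (if eqs w v then [ q ] else [ z ])

    sign : ∀ {m} → ℕ → Vec Reg m → Vec Reg m → Vec Reg m → Program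
    sign h u v w = ifEqs h w u (ifEqs h w v (emit h z) (emit h p)) (ifEqs h w v (emit h q) (emit h z))

    signᴿ : ∀ {h m} (u v w : Vec Reg m) s → Stable h u → Stable h v → Stable h w →
            Runs h (sign h u v w) (m * 4 + (m * 4 + 2))
              (signOut (Vec.map (reg s) u) (Vec.map (reg s) v) (Vec.map (reg s) w)) s
    signᴿ u v w s su sv sw = ifEqsᴿ w u s sw su
      (λ s′ f → runs-output (cong₂ (λ w v → if eqs w v then [ z ] else [ p ]) (sw f) (sv f))
        (ifEqsᴿ w v s′ sw sv (λ _ _ → emitᴿ) (λ _ _ → emitᴿ)))
      (λ s′ f → runs-output (cong₂ (λ w v → if eqs w v then [ q ] else [ z ]) (sw f) (sv f))
        (ifEqsᴿ w v s′ sw sv (λ _ _ → emitᴿ) (λ _ _ → emitᴿ)))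

    -- As letter 0 stands for the constant 1, the one offset `n * a + b` reaches every coefficient:
    -- the constant at 0, the linear ones from 1 on, and the row of the variable `a` in the
    -- quadratic part from `n * a + 1` on.
    fetch : (h base x y : ℕ) → Program
    fetch h base x y = multiply h 0 x 2 ⨾ instr (add h h y) ⨾ instr (add h h base) ⨾ instr (load h h) ⨾ instr (write h)

    fetchᴿ : ∀ {h base x y n} s → 3 ≤ h → base < h → x < h → y < h → Constants s → reg s 2 ≡ n →
             Runs h (fetch h base x y) (n * 4 + 7) [ mem s (n * reg s x + reg s y + reg s base) ] s
    fetchᴿ {h} {base} {x} {y} {n} s 3≤h base<h x<h y<h ok n≡ =
      let (R , v) = multiplyᴿ {h} {0} s (≤-trans (n≤1+n 2) 3≤h) x<h 3≤h ok refl n≡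
          R₁ = addᴿ {h} {h} {h} {y} {final R} ≤-refl
          R₂ = addᴿ {h} {h} {h} {base} {final R₁} ≤-refl
          R₃ = loadᴿ {h} {h} {h} {final R₂} ≤-refl
          v₁ : reg (final R₁) h ≡ n * reg s x + reg s y
          v₁ = trans (≔-same (reg (final R)) h) (cong₂ _+_ v (reg≡ (frame R) y<h))
          v₂ : reg (final R₂) h ≡ n * reg s x + reg s y + reg s base
          v₂ = trans (≔-same (reg (final R₁)) h) (cong₂ _+_ v₁ (reg≡ (frame (R ⨾ᴿ R₁)) base<h))
      in runs-≤ ≤-refl (≤-reflexive (+-assoc (n * 4) 3 4))
           (runs-output (cong [_] (trans (≔-same (reg (final R₂)) h)
              (trans (cong (λ f → f (reg (final R₂) h)) (mem≡ (frame R))) (cong (mem s) v₂))))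
           (R ⨾ᴿ R₁ ⨾ᴿ R₂ ⨾ᴿ R₃ ⨾ᴿ writeᴿ))

    -- A linear monomial is represented by the pair with `a` equal to 0 only. For the reversed pair
    -- the offset would hit the coefficient of another monomial, so `z` is written instead.
    entryOut : (μ : ℕ → ℕ) (n base a b : ℕ) → List ℕ
    entryOut μ n base a b =
      if a ≡ᵇ 0 then [ μ (n * a + b + base) ] else (if b ≡ᵇ 0 then [ z ] else [ μ (n * a + b + base) ])

    entry : (h base x y : ℕ) → Program
    entry h base x y = ifZero x (fetch h base x y) (ifZero y (emit h z) (fetch h base x y))

    entryᴿ : ∀ {h base x y n} s → 3 ≤ h → base < h → x < h → y < h → Constants s → reg s 2 ≡ n →
             Runs h (entry h base x y) (n * 4 + 9) (entryOut (mem s) n (reg s base) (reg s x) (reg s y)) s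
    entryᴿ {n = n} s 3≤h base<h x<h y<h ok n≡ =
      runs-≤ ≤-refl (≤-reflexive (trans (+-comm 1 _) (trans (+-assoc (n * 4) 8 1) refl))) (ifZeroᴿ s
        (runs-≤ ≤-refl (+-monoʳ-≤ (n * 4) (n≤1+n 7)) F)
        (runs-≤ ≤-refl (≤-reflexive (sym (+-suc (n * 4) 7)))
          (ifZeroᴿ s (runs-≤ ≤-refl (≤-trans (m≤m+n 2 5) (m≤n+m 7 (n * 4))) emitᴿ) F)))
      where F = fetchᴿ s 3≤h base<h x<h y<h ok n≡

  -- The outer nest numbers the equations of a family, the inner one the entries of a coefficient
  -- matrix. Once `M` is `D + D`, the inner words are a row followed by a column, and lexicographic
  -- order is the row by row order of the encoding.
  square : (M a : ℕ) → Program → Program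
  square M a P = nest M a (nest M (top M a) P)

  squareOut : (B M : ℕ) → (Vec ℕ M → Vec ℕ M → List ℕ) → List ℕ
  squareOut B M g = nestOut B M (λ e → nestOut B M (g e))

  squareTime : (B M T : ℕ) → ℕ
  squareTime B M T = nestTime B M (nestTime B M T)

  squareᴿ : ∀ M a {B T P} s (g : Vec ℕ M → Vec ℕ M → List ℕ) → 4 ≤ a → Constants s → reg s 3 ≡ B →
            (∀ s′ → Agree a s s′ → Runs (top M (top M a)) P T
               (g (Vec.map (reg s′) (digitRegs M a)) (Vec.map (reg s′) (digitRegs M (top M a)))) s′) →
            Runs a (square M a P) (squareTime B M T) (squareOut B M g) s
  squareᴿ M a {B} s g 4≤a ok B≡ body =
    nestᴿ M a s (λ e → nestOut B M (g e)) 4≤a ok B≡ λ s₁ p₁ →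
      nestᴿ M (top M a) s₁ (g (Vec.map (reg s₁) (digitRegs M a))) (≤-trans 4≤a (≤-top M a))
        (constants-agree (≤-trans (s≤s (s≤s z≤n)) 4≤a) p₁ ok) (trans (reg≡ p₁ 4≤a) B≡) λ s₂ p₂ →
          runs-output (cong (λ e → g e _) (digitRegs-agree M a p₂))
            (body s₂ (agree-trans p₁ (agree-≤ (≤-top M a) p₂)))

  sequence : ∀ t → (Fin t → Program) → Program
  sequence zero    P = skip
  sequence (suc t) P = P zero ⨾ sequence t (λ i → P (suc i))

  sequenceᴿ : ∀ {h T} t {P : Fin t → Program} {o : Fin t → List ℕ} s →
              (∀ i s′ → Agree h s s′ → Runs h (P i) T (o i) s′) →
              Runs h (sequence t P) (t * T + 1) (concat (tabulate o)) s
  sequenceᴿ zero    s body = skipᴿ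
  sequenceᴿ {h} {T} (suc t) s body =
    let R = body zero s agree-refl
    in runs-≤ ≤-refl (≤-reflexive (sym (+-assoc T (t * T) 1)))
         (R ⨾ᴿ sequenceᴿ t (final R) (λ i s′ p → body (suc i) s′ (agree-trans (frame R) p)))

  -- The program that writes the linear system.

  module Generator (D m z p q : ℕ) where

    -- The form `2 + m` exposes two letters to pattern matching, the room for a quadratic monomial.
    -- In `Reduction` it unfolds to `D + D`.
    M : ℕ
    M = 2 + m

    -- Registers 2, 3, 4, 5 hold n, n + 1, the number of polynomials and the
    -- length of the encoding of a polynomial.
    setup : Program
    setup = instr (set 1 1) ⨾ instr (load 2 0) ⨾ instr (add 3 2 1) ⨾ instr (load 4 1) ⨾
            multiply 6 0 2 2 ⨾ instr (add 5 3 6)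

    -- `power` multiplies what its register already holds. Starting from 1 it gives `N`; starting
    -- from the number of families, `suc M` templates and one for each polynomial, it gives the
    -- number of equations.
    header : Program
    header = instr (set 6 1) ⨾ power D 6 ⨾ instr (write 6) ⨾
             instr (set 6 (suc M)) ⨾ instr (add 6 6 4) ⨾ power M 6 ⨾ instr (write 6)

    -- No word is rearranged at run time: `lhs` and `rhs` act on register names, and register 0,
    -- which holds 0, doubles as the letter for 1.
    template : Fin (suc M) → Program
    template t = square M 6 (sign z p q h (lhs t 0 E) (rhs t 0 E) W)
      where
        h = top M (top M 6)
        E = digitRegs M 6
        W = digitRegs M (top M 6)

    -- Register 6 is the address of the current polynomial; it starts at 2, behind the cells with
    -- `n` and the number of polynomials. The offsets in `12 = 8 + 4` and `4 + h₁` skip two letters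
    -- each: the remaining letters of the entry must match those of the equation, and the first two
    -- letters of the entry select the coefficient.
    polynomials : Program
    polynomials = for 6 2 5 4 (square M 8
        (ifEqs h (digitRegs m (4 + h₁)) (digitRegs m 12) (entry z p q h 6 h₁ (2 + h₁)) (emit h z)))
      where
        h₁ = top M 8
        h  = top M h₁

    program : Program
    program = setup ⨾ header ⨾ sequence (suc M) template ⨾ polynomials

    polyOut : (μ : ℕ → ℕ) (n base : ℕ) → Vec ℕ M → Vec ℕ M → List ℕ
    polyOut μ n base (_ ∷ _ ∷ e) (a ∷ b ∷ w) = if eqs w e then entryOut z p q μ n base a b else [ z ]

    record Ready (μ : ℕ → ℕ) (n r : ℕ) (s : State) : Set where
      field
        base : Constants s
        n≡   : reg s 2 ≡ n
        B≡   : reg s 3 ≡ suc n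
        r≡   : reg s 4 ≡ r
        l≡   : reg s 5 ≡ suc n + n * n
        μ≡   : mem s ≡ μ

    ready-agree : ∀ {h μ n r s s′} → 6 ≤ h → Agree h s s′ → Ready μ n r s → Ready μ n r s′
    ready-agree 6≤h a R = record
      { base = constants-agree (≤-trans (≤ᵇ⇒≤ 2 6 _) 6≤h) a base
      ; n≡   = trans (reg≡ a (≤-trans (≤ᵇ⇒≤ 3 6 _) 6≤h)) n≡
      ; B≡   = trans (reg≡ a (≤-trans (≤ᵇ⇒≤ 4 6 _) 6≤h)) B≡
      ; r≡   = trans (reg≡ a (≤-trans (≤ᵇ⇒≤ 5 6 _) 6≤h)) r≡
      ; l≡   = trans (reg≡ a 6≤h) l≡
      ; μ≡   = trans (mem≡ a) μ≡
      }
      where open Ready R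

    setupᴿ : ∀ n r ns → Σ (Runs 0 setup (n * 4 + 8) [] (initial (n ∷ r ∷ ns))) λ R →
                          Ready (nth (n ∷ r ∷ ns)) n r (final R)
    setupᴿ n r ns =
      let s₀ = initial (n ∷ r ∷ ns)
          S₁ = setᴿ {0} {1} {1} {s₀} z≤n
          S₂ = loadᴿ {0} {2} {0} {final S₁} z≤n
          S₃ = addᴿ {0} {3} {2} {1} {final S₂} z≤n
          S₄ = loadᴿ {0} {4} {1} {final S₃} z≤n
          s₄ = final S₄
          (S₅ , v) = multiplyᴿ {6} {0} {2} {2} {n} {n} s₄ (≤ᵇ⇒≤ 2 6 _) (≤ᵇ⇒≤ 3 6 _) (≤ᵇ⇒≤ 3 6 _)
                       (constants refl refl) refl refl
          S₆ = addᴿ {0} {5} {3} {6} {final S₅} z≤n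
          f  = frame S₅
      in runs-≤ ≤-refl (≤-reflexive (time (n * 4)))
           (S₁ ⨾ᴿ S₂ ⨾ᴿ S₃ ⨾ᴿ S₄ ⨾ᴿ runs-≤ z≤n ≤-refl S₅ ⨾ᴿ S₆)
         , record
           { base = constants (reg≡ f (≤ᵇ⇒≤ 1 6 _)) (reg≡ f (≤ᵇ⇒≤ 2 6 _))
           ; n≡   = reg≡ f (≤ᵇ⇒≤ 3 6 _)
           ; B≡   = trans (reg≡ f (≤ᵇ⇒≤ 4 6 _)) (+-comm n 1)
           ; r≡   = reg≡ f (≤ᵇ⇒≤ 5 6 _)
           ; l≡   = cong₂ _+_ (trans (reg≡ f (≤ᵇ⇒≤ 4 6 _)) (+-comm n 1)) v
           ; μ≡   = mem≡ f
           }
      where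
        time : ∀ a → 1 + (1 + (1 + (1 + (a + 3 + 1)))) ≡ a + 8
        time = solve-∀

    headerTime : ℕ → ℕ
    headerTime B = D * (B * 4 + 4) + M * (B * 4 + 4) + 7

    headerᴿ : ∀ {μ n r} s → Ready μ n r s →
              Runs 6 header (headerTime (suc n)) (suc n ^ D ∷ suc n ^ M * (suc M + r) ∷ []) s
    headerᴿ {μ} {n} {r} s rd =
      let open Ready rd
          S₁ = setᴿ {6} {6} {1} {s} ≤-refl
          ok₁ = ready-agree ≤-refl (frame S₁) rd
          (S₂ , v₂) = powerᴿ D 6 {suc n} (final S₁) (≤ᵇ⇒≤ 4 6 _) (Ready.base ok₁) (Ready.B≡ ok₁)
          S₃ = S₁ ⨾ᴿ S₂ ⨾ᴿ writeᴿ {x = 6}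
          S₄ = setᴿ {6} {6} {suc M} {final S₃} ≤-refl
          S₅ = addᴿ {6} {6} {6} {4} {final S₄} ≤-refl
          S₅′ = S₃ ⨾ᴿ S₄ ⨾ᴿ S₅
          ok₅ = ready-agree ≤-refl (frame S₅′) rd
          (S₆ , v₆) = powerᴿ M 6 {suc n} (final S₅) (≤ᵇ⇒≤ 4 6 _) (Ready.base ok₅) (Ready.B≡ ok₅)
          r₃ = Ready.r≡ (ready-agree ≤-refl (frame S₃) rd)
      in runs-≤ ≤-refl (≤-reflexive (time (D * (suc n * 4 + 4)) (M * (suc n * 4 + 4))))
         (runs-output (cong₂ (λ x y → x ∷ y ∷ []) (trans v₂ (*-identityʳ _))
              (trans v₆ (cong (λ y → suc n ^ M * (suc M + y)) r₃)))
           (S₁ ⨾ᴿ S₂ ⨾ᴿ writeᴿ {x = 6} ⨾ᴿ S₄ ⨾ᴿ S₅ ⨾ᴿ S₆ ⨾ᴿ writeᴿ {x = 6}))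
      where
        time : ∀ a b → 1 + (a + 1 + (1 + (1 + (1 + (b + 1 + 1))))) ≡ a + b + 7
        time = solve-∀

    templateTime : ℕ → ℕ
    templateTime B = squareTime B M (M * 4 + (M * 4 + 2))

    templateOut : ℕ → Fin (suc M) → List ℕ
    templateOut B t = squareOut B M λ e → signOut z p q (lhs t 0 e) (rhs t 0 e)

    templateᴿ : ∀ {μ n r} t s → Ready μ n r s →
                Runs 6 (template t) (templateTime (suc n)) (templateOut (suc n) t) s
    templateᴿ t s rd = squareᴿ M 6 s (λ e → signOut z p q (lhs t 0 e) (rhs t 0 e)) (≤ᵇ⇒≤ 4 6 _) base B≡ λ s′ f →
        let 0≡ = zero≡ (Ready.base (ready-agree ≤-refl f rd))
        in runs-output
          (cong₂ (λ u v → signOut z p q u v (Vec.map (reg s′) W))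
            (trans (map-lhs (reg s′) 0 t E) (cong (λ o → lhs t o (Vec.map (reg s′) E)) 0≡))
            (trans (map-rhs (reg s′) 0 t E) (cong (λ o → rhs t o (Vec.map (reg s′) E)) 0≡)))
          (signᴿ z p q (lhs t 0 E) (rhs t 0 E) W s′
            (λ {s₁} {s₂} g → trans (map-lhs (reg s₂) 0 t E)
               (trans (cong₂ (lhs t) (reg≡ g 0<h) (digitRegs-agree M 6 (agree-≤ (≤-top M h₁) g)))
                      (sym (map-lhs (reg s₁) 0 t E))))
            (λ {s₁} {s₂} g → trans (map-rhs (reg s₂) 0 t E)
               (trans (cong₂ (rhs t) (reg≡ g 0<h) (digitRegs-agree M 6 (agree-≤ (≤-top M h₁) g)))
                      (sym (map-rhs (reg s₁) 0 t E))))
            (λ g → digitRegs-agree M h₁ g))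
      where
        open Ready rd
        h₁ = top M 6
        E = digitRegs M 6
        W = digitRegs M h₁
        0<h : 0 < top M h₁
        0<h = ≤-trans (≤ᵇ⇒≤ 1 6 _) (≤-trans (≤-top M 6) (≤-top M h₁))

    polynomialTime : ℕ → ℕ
    polynomialTime n = squareTime (suc n) M (m * 4 + (n * 4 + 9))

    polynomialsᴿ : ∀ {μ n r} s → Ready μ n r s →
                   Runs 6 polynomials (r * (polynomialTime n + 3) + 3)
                     (progression (λ b → squareOut (suc n) M (polyOut μ n b)) (suc n + n * n) r 2) s
    polynomialsᴿ {μ} {n} {r} s rd = proj₁ (forᴿ s (≤ᵇ⇒≤ 2 6 _) ≤-refl (≤ᵇ⇒≤ 5 6 _) base l≡ r≡ λ s₁ f₁ →
        let rd₁ = ready-agree ≤-refl f₁ rd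
        in squareᴿ M 8 s₁ (polyOut μ n (reg s₁ 6)) (≤ᵇ⇒≤ 4 8 _) (Ready.base rd₁) (Ready.B≡ rd₁) λ s₂ f₂ →
          let rd₂ = ready-agree (≤ᵇ⇒≤ 6 8 _) f₂ rd₁
          in ifEqsᴿ (digitRegs m (4 + h₁)) (digitRegs m 12) s₂
               (digitRegs-agree m (4 + h₁))
               (λ g → digitRegs-agree m 12 (agree-≤ (≤-trans (m≤n+m h₁ 4) (≤-top m (4 + h₁))) g))
               (λ s₃ f₃ → let rd₃ = ready-agree 6≤h f₃ rd₂ in
                 runs-output (cong₄ (λ μ′ b x y → entryOut z p q μ′ n b x y) (Ready.μ≡ rd₃)
                     (trans (reg≡ f₃ 6<h) (reg≡ f₂ (≤ᵇ⇒≤ 7 8 _)))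
                     (reg≡ f₃ x<h) (reg≡ f₃ y<h))
                   (entryᴿ z p q s₃ (≤-trans (≤ᵇ⇒≤ 3 6 _) 6≤h) 6<h x<h y<h (Ready.base rd₃) (Ready.n≡ rd₃)))
               (λ s₃ f₃ → runs-≤ ≤-refl (≤-trans (≤ᵇ⇒≤ 2 9 _) (m≤n+m 9 (n * 4))) emitᴿ))
      where
        open Ready rd
        h₁ = top M 8
        8≤h₁ : 8 ≤ h₁
        8≤h₁ = ≤-top M 8
        4+h₁≤h : 4 + h₁ ≤ top M h₁
        4+h₁≤h = ≤-top m (4 + h₁)
        x<h : h₁ < top M h₁
        x<h = ≤-trans (m≤n+m (suc h₁) 3) 4+h₁≤h
        y<h : 2 + h₁ < top M h₁
        y<h = ≤-trans (n≤1+n _) 4+h₁≤h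
        6≤h : 6 ≤ top M h₁
        6≤h = ≤-trans (≤ᵇ⇒≤ 6 8 _) (≤-trans 8≤h₁ (<⇒≤ x<h))
        6<h : 6 < top M h₁
        6<h = ≤-trans (≤ᵇ⇒≤ 7 8 _) (≤-trans 8≤h₁ (<⇒≤ x<h))
        cong₄ : ∀ {A B C D E : Set} (f : A → B → C → D → E) {a a′ b b′ c c′ d d′} →
                a ≡ a′ → b ≡ b′ → c ≡ c′ → d ≡ d′ → f a b c d ≡ f a′ b′ c′ d′
        cong₄ f refl refl refl refl = refl

    time : ℕ → ℕ → ℕ
    time n r = n * 4 + 8 + (headerTime (suc n) +
               (suc M * templateTime (suc n) + 1 + (r * (polynomialTime n + 3) + 3)))

    outputOf : (n r : ℕ) (ns : List ℕ) → List ℕ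
    outputOf n r ns = suc n ^ D ∷ suc n ^ M * (suc M + r) ∷ concat (tabulate (templateOut (suc n))) ++
      progression (λ b → squareOut (suc n) M (polyOut (nth (n ∷ r ∷ ns)) n b)) (suc n + n * n) r 2

    programᴿ : ∀ n r ns → Runs 0 program (time n r) (outputOf n r ns) (initial (n ∷ r ∷ ns))
    programᴿ n r ns =
      let (R₁ , rd₁) = setupᴿ n r ns
          R₂  = headerᴿ (final R₁) rd₁
          rd₂ = ready-agree ≤-refl (frame R₂) rd₁
          R₃  = sequenceᴿ (suc M) {o = templateOut (suc n)} (final R₂)
                  (λ t s′ f → templateᴿ t s′ (ready-agree ≤-refl f rd₂))
          R₄  = polynomialsᴿ (final R₃) (ready-agree ≤-refl (frame R₃) rd₂)
      in R₁ ⨾ᴿ runs-≤ z≤n ≤-refl (R₂ ⨾ᴿ R₃ ⨾ᴿ R₄)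

-- Numbering of words and layout of the encodings.

module Encoding where

  open Machine
  open import Data.Fin using (Fin; zero; suc; toℕ; combine; quotient; remainder; _↑ˡ_; _↑ʳ_)
  open import Data.Fin.Properties using (remQuot-combine; combine-remQuot)
  open import Data.List using (List; []; _∷_; _++_; [_]; concat; tabulate; length)
  open import Data.List.Properties using (++-assoc; ++-identityʳ; tabulate-cong; length-++)
  open import Data.Nat
  open import Data.Nat.Properties
  open import Data.Product using (_,_)
  open import Data.Vec as Vec using (Vec; []; _∷_)
  open import Function using (_∘_)
  open import Relation.Binary.PropositionalEquality hiding ([_])

  progression-cong : ∀ {g g′ : ℕ → List ℕ} δ c v → (∀ x → g x ≡ g′ x) → progression g δ c v ≡ progression g′ δ c v
  progression-cong δ zero    v e = refl
  progression-cong δ (suc c) v e = cong₂ _++_ (e v) (progression-cong δ c (v + δ) e)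

  progression-tabulate : ∀ (g : ℕ → List ℕ) δ c v →
                         progression g δ c v ≡ concat (tabulate {n = c} (λ i → g (v + toℕ i * δ)))
  progression-tabulate g δ zero    v = refl
  progression-tabulate g δ (suc c) v = cong₂ _++_ (cong g (sym (+-identityʳ v)))
    (trans (progression-tabulate g δ c (v + δ))
      (cong concat (tabulate-cong (λ (i : Fin c) → cong g (+-assoc v δ (toℕ i * δ))))))

  nestOut-++ : ∀ B d {d′} (g : Vec ℕ (d + d′) → List ℕ) →
               nestOut B (d + d′) g ≡ nestOut B d (λ u → nestOut B d′ (λ v → g (u Vec.++ v)))
  nestOut-++ B zero    g = refl
  nestOut-++ B (suc d) g = progression-cong 1 B 0 (λ x → nestOut-++ B d (λ w → g (x ∷ w)))

  module _ {A : Set} where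

    concat-tabulate-cong : ∀ {a} {f g : Fin a → List A} → (∀ i → f i ≡ g i) → concat (tabulate f) ≡ concat (tabulate g)
    concat-tabulate-cong e = cong concat (tabulate-cong e)

    concat-tabulate-+ : ∀ a b (f : Fin (a + b) → List A) →
      concat (tabulate f) ≡ concat (tabulate (λ i → f (i ↑ˡ b))) ++ concat (tabulate (λ j → f (a ↑ʳ j)))
    concat-tabulate-+ zero    b f = refl
    concat-tabulate-+ (suc a) b f = trans (cong (f zero ++_) (concat-tabulate-+ a b (f ∘ suc)))
      (sym (++-assoc (f zero) _ _))

    concat-tabulate-* : ∀ a b (f : Fin (a * b) → List A) →
      concat (tabulate f) ≡ concat (tabulate (λ i → concat (tabulate (λ j → f (combine {a} {b} i j)))))
    concat-tabulate-* zero    b f = refl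
    concat-tabulate-* (suc a) b f = trans (concat-tabulate-+ b (a * b) f)
      (cong (concat (tabulate (λ j → f (j ↑ˡ (a * b)))) ++_) (concat-tabulate-* a b (λ i → f (b ↑ʳ i))))

    concat-tabulate-[] : ∀ {a} (f : Fin a → A) → concat (tabulate (λ i → [ f i ])) ≡ tabulate f
    concat-tabulate-[] {zero}  f = refl
    concat-tabulate-[] {suc a} f = cong (f zero ∷_) (concat-tabulate-[] (f ∘ suc))

    length-concat-tabulate : ∀ {a b} (f : Fin a → List A) → (∀ i → length (f i) ≡ b) →
                             length (concat (tabulate f)) ≡ a * b
    length-concat-tabulate {zero}  f e = refl
    length-concat-tabulate {suc a} f e = trans (length-++ (f zero))
      (cong₂ _+_ (e zero) (length-concat-tabulate (f ∘ suc) (e ∘ suc)))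

  module _ {B : ℕ} where

    -- The most significant digit comes first, so that counting through `Fin (B ^ d)` visits the
    -- words in the order of the loop nest.
    digits : ∀ d → Fin (B ^ d) → Vec (Fin B) d
    digits zero    i = []
    digits (suc d) i = quotient {B} (B ^ d) i ∷ digits d (remainder {B} (B ^ d) i)

    index : ∀ {d} → Vec (Fin B) d → Fin (B ^ d)
    index []      = zero
    index (a ∷ w) = combine a (index w)

    digits-combine : ∀ d a i → digits (suc d) (combine a i) ≡ a ∷ digits d i
    digits-combine d a i = cong (λ (b , j) → b ∷ digits d j) (remQuot-combine a i)

    digits-index : ∀ {d} (w : Vec (Fin B) d) → digits d (index w) ≡ w
    digits-index {zero}  []      = refl
    digits-index {suc d} (a ∷ w) = trans (digits-combine d a (index w)) (cong (a ∷_) (digits-index w))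

    index-digits : ∀ d (i : Fin (B ^ d)) → index (digits d i) ≡ i
    index-digits zero    zero = refl
    index-digits (suc d) i    = trans (cong (combine (quotient {B} (B ^ d) i)) (index-digits d _))
                                      (combine-remQuot {B} (B ^ d) i)

    -- The bridge between encodings, which tabulate over indices in `Fin (B ^ d)`, and loop nests,
    -- which run over words of numbers. The leading digit is the outermost loop.
    tabulate-digits : ∀ d {g : Vec ℕ d → List ℕ} {h : Vec (Fin B) d → List ℕ} →
                      (∀ w → g (Vec.map toℕ w) ≡ h w) →
                      concat (tabulate (λ i → h (digits d i))) ≡ nestOut B d g
    tabulate-digits zero    e = trans (++-identityʳ _) (sym (e []))
    tabulate-digits (suc d) {g} {h} e = begin
      concat (tabulate (λ i → h (digits (suc d) i)))
        ≡⟨ concat-tabulate-* B (B ^ d) (λ i → h (digits (suc d) i)) ⟩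
      concat (tabulate {n = B} (λ a → concat (tabulate {n = B ^ d} (λ i → h (digits (suc d) (combine a i))))))
        ≡⟨ concat-tabulate-cong (λ a → concat-tabulate-cong (λ i → cong h (digits-combine d a i))) ⟩
      concat (tabulate (λ a → concat (tabulate (λ i → h (a ∷ digits d i)))))
        ≡⟨ concat-tabulate-cong (λ a → tabulate-digits d {λ w → g (toℕ a ∷ w)} (λ w → e (a ∷ w))) ⟩
      concat (tabulate {n = B} (λ a → nestOut B d (λ w → g (toℕ a ∷ w))))
        ≡⟨ concat-tabulate-cong {a = B} (λ a → cong (λ x → nestOut B d (λ w → g (x ∷ w))) (*-identityʳ (toℕ a))) ⟨
      concat (tabulate {n = B} (λ a → nestOut B d (λ w → g (toℕ a * 1 ∷ w))))
        ≡⟨ progression-tabulate (λ x → nestOut B d (λ w → g (x ∷ w))) 1 B 0 ⟨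
      nestOut B (suc d) g ∎
      where open ≡-Reasoning

  nth-++ˡ : ∀ xs ys {x} → x < length xs → nth (xs ++ ys) x ≡ nth xs x
  nth-++ˡ (_ ∷ xs) ys {zero}  l       = refl
  nth-++ˡ (_ ∷ xs) ys {suc x} (s≤s l) = nth-++ˡ xs ys l

  nth-++ʳ : ∀ xs ys x → nth (xs ++ ys) (length xs + x) ≡ nth ys x
  nth-++ʳ []       ys x = refl
  nth-++ʳ (_ ∷ xs) ys x = nth-++ʳ xs ys x

  nth-tabulate : ∀ {a} (f : Fin a → ℕ) i → nth (tabulate f) (toℕ i) ≡ f i
  nth-tabulate f zero    = refl
  nth-tabulate f (suc i) = nth-tabulate (f ∘ suc) i

  nth-concat-tabulate : ∀ {a b} (f : Fin a → List ℕ) → (∀ i → length (f i) ≡ b) → ∀ i {x} → x < b →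
                        nth (concat (tabulate f)) (toℕ i * b + x) ≡ nth (f i) x
  nth-concat-tabulate f e zero    x<b = nth-++ˡ (f zero) _ (subst (_ <_) (sym (e zero)) x<b)
  nth-concat-tabulate {b = b} f e (suc i) {x} x<b = begin
    nth (f zero ++ rest) (b + toℕ i * b + x)               ≡⟨ cong (nth (f zero ++ rest)) (+-assoc b (toℕ i * b) x) ⟩
    nth (f zero ++ rest) (b + (toℕ i * b + x))             ≡⟨ cong (λ l → nth (f zero ++ rest) (l + (toℕ i * b + x))) (e zero) ⟨
    nth (f zero ++ rest) (length (f zero) + (toℕ i * b + x)) ≡⟨ nth-++ʳ (f zero) rest (toℕ i * b + x) ⟩
    nth rest (toℕ i * b + x)                               ≡⟨ nth-concat-tabulate (f ∘ suc) (e ∘ suc) i x<b ⟩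
    nth (f (suc i)) x                                      ∎
    where
      open ≡-Reasoning
      rest = concat (tabulate (f ∘ suc))

-- Polynomial bounds on running time and matrix size.

module Time where

  open Machine
  open import Data.Nat
  open import Data.Nat.Properties
  open import Data.Nat.Tactic.RingSolver using (solve-∀)
  open import Relation.Binary.PropositionalEquality hiding ([_])

  open ≤-Reasoning

  n≤w^n : ∀ {w} n → 2 ≤ w → n ≤ w ^ n
  n≤w^n         zero    2≤w = z≤n
  n≤w^n {w}     (suc n) 2≤w = begin
    suc n            ≤⟨ +-mono-≤ (m^n>0 w {{>-nonZero (≤-trans (s≤s z≤n) 2≤w)}} n) (n≤w^n n 2≤w) ⟩
    w ^ n + w ^ n    ≡⟨ cong (w ^ n +_) (+-identityʳ (w ^ n)) ⟨
    2 * w ^ n        ≤⟨ *-monoˡ-≤ (w ^ n) 2≤w ⟩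
    w * w ^ n        ∎

  -- The 7 is 1 + 3 + 3: as `B` and `x` are at least 1, `B * x + 3 * B + 3` is at most
  -- `7 * (B * x)`. Loop overhead thus becomes a constant factor per level and the bound a pure
  -- power.
  nestTime≤ : ∀ B d {T} → 1 ≤ B → 1 ≤ T → nestTime B d T ≤ (7 * B) ^ d * T
  nestTime≤ B zero    {T} 1≤B 1≤T = ≤-reflexive (sym (+-identityʳ T))
  nestTime≤ B (suc d) {T} 1≤B 1≤T = begin
    B * (nestTime B d T + 3) + 3   ≤⟨ +-monoˡ-≤ 3 (*-monoʳ-≤ B (+-monoˡ-≤ 3 (nestTime≤ B d 1≤B 1≤T))) ⟩
    B * (x + 3) + 3                ≡⟨ expand B x ⟩
    B * x + (3 * (B * 1) + 3 * 1)  ≤⟨ +-monoʳ-≤ (B * x) (+-mono-≤ (*-monoʳ-≤ 3 (*-monoʳ-≤ B 1≤x)) (*-monoʳ-≤ 3 (*-mono-≤ 1≤B 1≤x))) ⟩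
    B * x + (3 * (B * x) + 3 * (B * x)) ≡⟨ collect B ((7 * B) ^ d) T ⟩
    7 * B * (7 * B) ^ d * T        ∎
    where
      x = (7 * B) ^ d * T
      1≤x : 1 ≤ x
      1≤x = *-mono-≤ (m^n>0 (7 * B) {{>-nonZero (≤-trans 1≤B (m≤n*m B 7))}} d) 1≤T
      expand : ∀ B x → B * (x + 3) + 3 ≡ B * x + (3 * (B * 1) + 3 * 1)
      expand = solve-∀
      collect : ∀ B y T → B * (y * T) + (3 * (B * (y * T)) + 3 * (B * (y * T))) ≡ 7 * B * y * T
      collect = solve-∀

  module _ (D m z p q : ℕ) where

    open Generator D m z p q

    -- Everything is measured in `Y`, which bounds `n`, `D`, `M` and the factor contributed by one
    -- nest. The dearest part has four such factors: two nests, the number of templates and the work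
    -- per entry. The constants add up to `59 + r * 20`, and `Y ^ 2` absorbs 59 because `Y` is at
    -- least 49.
    time≤ : ∀ n r → D ≤ M → time n r ≤ suc r * ((7 * suc n) ^ M) ^ 6
    time≤ n r D≤M = begin
      time n r
        ≤⟨ +-mono-≤ setup≤ (+-mono-≤ header≤ (+-mono-≤ (+-mono-≤ template≤ 1≤Q)
             (+-mono-≤ (*-monoʳ-≤ r (+-mono-≤ polynomial≤ (*-monoʳ-≤ 3 1≤Q))) (*-monoʳ-≤ 3 1≤Q)))) ⟩
      12 * Q + (23 * Q + (20 * Q + Q + (r * (17 * Q + 3 * Q) + 3 * Q)))
        ≡⟨ collect Q r ⟩
      (59 + r * 20) * Q
        ≤⟨ *-monoˡ-≤ Q (+-monoʳ-≤ 59 (*-monoʳ-≤ r {20} {59} (≤ᵇ⇒≤ 20 59 _))) ⟩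
      suc r * 59 * Q
        ≤⟨ *-monoˡ-≤ Q (*-monoʳ-≤ (suc r) 59≤Y²) ⟩
      suc r * Y ^ 2 * Q
        ≡⟨ *-assoc (suc r) (Y ^ 2) Q ⟩
      suc r * (Y ^ 2 * Q)
        ≡⟨ cong (suc r *_) (^-distribˡ-+-* Y 2 4) ⟨
      suc r * Y ^ 6 ∎
      where
        B = suc n
        Y = (7 * B) ^ M
        Q = Y ^ 4
        7≤7B : 7 ≤ 7 * B
        7≤7B = m≤m*n 7 B
        1≤7B : 1 ≤ 7 * B
        1≤7B = ≤-trans (≤ᵇ⇒≤ 1 7 _) 7≤7B
        49≤Y : 49 ≤ Y
        49≤Y = ≤-trans (^-monoˡ-≤ 2 7≤7B) (^-monoʳ-≤ (7 * B) {{>-nonZero 1≤7B}} (m≤m+n 2 m))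
        59≤Y² : 59 ≤ Y ^ 2
        59≤Y² = ≤-trans (≤ᵇ⇒≤ 59 2401 _) (^-monoˡ-≤ 2 49≤Y)
        1≤Y : 1 ≤ Y
        1≤Y = ≤-trans (≤ᵇ⇒≤ 1 49 _) 49≤Y
        B≤Y : B ≤ Y
        B≤Y = ≤-trans (m≤n*m B 7) (≤-trans (≤-reflexive (sym (*-identityʳ (7 * B))))
                (^-monoʳ-≤ (7 * B) {{>-nonZero 1≤7B}} (s≤s (z≤n {suc m}))))
        M≤Y : M ≤ Y
        M≤Y = n≤w^n M (≤-trans (≤ᵇ⇒≤ 2 7 _) 7≤7B)
        Y≤Q : ∀ i → i ≤ 4 → Y ^ i ≤ Q
        Y≤Q i = ^-monoʳ-≤ Y {{>-nonZero 1≤Y}}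
        1≤Q : 1 ≤ Q
        1≤Q = Y≤Q 0 z≤n
        ≤Y⇒≤Q : ∀ {x} → x ≤ Y → x ≤ Q
        ≤Y⇒≤Q x≤Y = ≤-trans x≤Y (≤-trans (≤-reflexive (sym (*-identityʳ Y))) (Y≤Q 1 (≤ᵇ⇒≤ 1 4 _)))
        ≤Y*Y⇒≤Q : ∀ {x y} → x ≤ Y → y ≤ Y → x * y ≤ Q
        ≤Y*Y⇒≤Q x≤Y y≤Y = ≤-trans (*-mono-≤ x≤Y (≤-trans y≤Y (≤-reflexive (sym (*-identityʳ Y))))) (Y≤Q 2 (≤ᵇ⇒≤ 2 4 _))
        n≤Y : n ≤ Y
        n≤Y = ≤-trans (n≤1+n n) B≤Y

        setup≤ : n * 4 + 8 ≤ 12 * Q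
        setup≤ = begin
          n * 4 + 8 * 1  ≤⟨ +-mono-≤ (*-monoˡ-≤ 4 (≤Y⇒≤Q n≤Y)) (*-monoʳ-≤ 8 1≤Q) ⟩
          Q * 4 + 8 * Q  ≡⟨ eq Q ⟩
          12 * Q         ∎
          where
            eq : ∀ Q → Q * 4 + 8 * Q ≡ 12 * Q
            eq = solve-∀

        header≤ : headerTime B ≤ 23 * Q
        header≤ = begin
          D * (B * 4 + 4) + M * (B * 4 + 4) + 7
            ≡⟨ eq D M B ⟩
          4 * (D * B) + 4 * D + (4 * (M * B) + 4 * M) + 7 * 1
            ≤⟨ +-mono-≤ (+-mono-≤ (+-mono-≤ (*-monoʳ-≤ 4 (≤Y*Y⇒≤Q D≤Y B≤Y)) (*-monoʳ-≤ 4 (≤Y⇒≤Q D≤Y)))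
                 (+-mono-≤ (*-monoʳ-≤ 4 (≤Y*Y⇒≤Q M≤Y B≤Y)) (*-monoʳ-≤ 4 (≤Y⇒≤Q M≤Y)))) (*-monoʳ-≤ 7 1≤Q) ⟩
          4 * Q + 4 * Q + (4 * Q + 4 * Q) + 7 * Q
            ≡⟨ eq′ Q ⟩
          23 * Q ∎
          where
            D≤Y = ≤-trans D≤M M≤Y
            eq : ∀ D M B → D * (B * 4 + 4) + M * (B * 4 + 4) + 7 ≡ 4 * (D * B) + 4 * D + (4 * (M * B) + 4 * M) + 7 * 1
            eq = solve-∀
            eq′ : ∀ Q → 4 * Q + 4 * Q + (4 * Q + 4 * Q) + 7 * Q ≡ 23 * Q
            eq′ = solve-∀

        square≤ : ∀ {T} → 1 ≤ T → squareTime B M T ≤ Y * (Y * T)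
        square≤ {T} 1≤T = begin
          nestTime B M (nestTime B M T)  ≤⟨ nestTime-mono M (nestTime≤ B M (s≤s z≤n) 1≤T) ⟩
          nestTime B M (Y * T)           ≤⟨ nestTime≤ B M (s≤s z≤n) (*-mono-≤ 1≤Y 1≤T) ⟩
          Y * (Y * T)                    ∎
          where
            nestTime-mono : ∀ d {T U} → T ≤ U → nestTime B d T ≤ nestTime B d U
            nestTime-mono zero    T≤U = T≤U
            nestTime-mono (suc d) T≤U = +-monoˡ-≤ 3 (*-monoʳ-≤ B (+-monoˡ-≤ 3 (nestTime-mono d T≤U)))

        template≤ : suc M * templateTime B ≤ 20 * Q
        template≤ = begin
          suc M * templateTime B
            ≤⟨ *-mono-≤ (+-mono-≤ 1≤Y M≤Y) (≤-trans (square≤ (m≤n⇒m≤o+n (M * 4) (m≤n⇒m≤o+n (M * 4) (s≤s z≤n))))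
                 (*-monoʳ-≤ Y (*-monoʳ-≤ Y (+-mono-≤ (*-monoˡ-≤ 4 M≤Y) (+-mono-≤ (*-monoˡ-≤ 4 M≤Y) (*-monoʳ-≤ 2 1≤Y)))))) ⟩
          (Y + Y) * (Y * (Y * (Y * 4 + (Y * 4 + 2 * Y))))
            ≡⟨ eq Y ⟩
          20 * (Y * (Y * (Y * (Y * 1)))) ∎
          where
            eq : ∀ Y → (Y + Y) * (Y * (Y * (Y * 4 + (Y * 4 + 2 * Y)))) ≡ 20 * (Y * (Y * (Y * (Y * 1))))
            eq = solve-∀

        polynomial≤ : polynomialTime n ≤ 17 * Q
        polynomial≤ = begin
          polynomialTime n
            ≤⟨ ≤-trans (square≤ (m≤n⇒m≤o+n (m * 4) (m≤n⇒m≤o+n (n * 4) (s≤s z≤n))))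
                 (*-monoʳ-≤ Y (*-monoʳ-≤ Y (+-mono-≤ (*-monoˡ-≤ 4 (≤-trans (m≤n+m m 2) M≤Y)) (+-mono-≤ (*-monoˡ-≤ 4 n≤Y) (*-monoʳ-≤ 9 1≤Y))))) ⟩
          Y * (Y * (Y * 4 + (Y * 4 + 9 * Y)))
            ≡⟨ eq Y ⟩
          17 * Y ^ 3
            ≤⟨ *-monoʳ-≤ 17 (Y≤Q 3 (≤ᵇ⇒≤ 3 4 _)) ⟩
          17 * Q ∎
          where
            eq : ∀ Y → Y * (Y * (Y * 4 + (Y * 4 + 9 * Y))) ≡ 17 * (Y * (Y * (Y * 1)))
            eq = solve-∀

        collect : ∀ Q r → 12 * Q + (23 * Q + (20 * Q + Q + (r * (17 * Q + 3 * Q) + 3 * Q))) ≡ (59 + r * 20) * Q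
        collect = solve-∀

  1+n≤n² : ∀ {n} → 2 ≤ n → suc n ≤ n ^ 2
  1+n≤n² {n} 2≤n = begin
    1 + n      ≤⟨ +-monoˡ-≤ n (≤-trans (s≤s z≤n) 2≤n) ⟩
    n + n      ≡⟨ cong (n +_) (+-identityʳ n) ⟨
    2 * n      ≤⟨ *-monoˡ-≤ n 2≤n ⟩
    n * n      ≡⟨ cong (n *_) (*-identityʳ n) ⟨
    n ^ 2      ∎

  -- From `8 ≤ n ^ 3` and `1 + n ≤ n ^ 2`: for `n` at least 2, constant factors turn into powers of
  -- `n`, the only base that the final bound admits.
  7[1+n]≤n⁵ : ∀ {n} → 2 ≤ n → 7 * suc n ≤ n ^ 5
  7[1+n]≤n⁵ {n} 2≤n = begin
    7 * suc n      ≤⟨ *-mono-≤ (≤-trans (n≤1+n 7) (^-monoˡ-≤ 3 2≤n)) (1+n≤n² 2≤n) ⟩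
    n ^ 3 * n ^ 2  ≡⟨ ^-distribˡ-+-* n 3 2 ⟨
    n ^ 5          ∎

  -- Words have length M = 2 (2 + 3 k), and (7 (n + 1))^(6 M) ≤ n^(30 M).
  time-exponent : ∀ k → 1 ≤ k → 5 * ((2 + (k + (k + k))) + (2 + (k + (k + k)))) * 6 ≤ 300 * k
  time-exponent (suc k) _ = ≤-trans (m≤n+m (5 * (2 + (suc k + (suc k + suc k)) + (2 + (suc k + (suc k + suc k)))) * 6) (120 * k))
    (≤-reflexive (eq k))
    where
      eq : ∀ k → 120 * k + 5 * (2 + (suc k + (suc k + suc k)) + (2 + (suc k + (suc k + suc k)))) * 6 ≡ 300 * suc k
      eq = solve-∀

  size-exponent : ∀ k → 1 ≤ k → 2 * (2 + (k + (k + k))) ≤ 300 * k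
  size-exponent (suc k) _ = ≤-trans (m≤n+m (2 * (2 + (suc k + (suc k + suc k)))) (290 + 294 * k)) (≤-reflexive (eq k))
    where
      eq : ∀ k → 290 + 294 * k + 2 * (2 + (suc k + (suc k + suc k))) ≡ 300 * suc k
      eq = solve-∀

  -- The exponent `5 * M * 6` equals `180 * k + 120`. It is at most `300 * k` with equality at
  -- `k = 1`, which is where the constant 300 comes from.
  time-bound : ∀ {n r k} → 2 ≤ n → 1 ≤ k → let M = (2 + (k + (k + k))) + (2 + (k + (k + k))) in
               suc r * ((7 * suc n) ^ M) ^ 6 ≤ suc r * n ^ (300 * k)
  time-bound {n} {r} {k} 2≤n 1≤k = *-monoʳ-≤ (suc r) (begin
    ((7 * suc n) ^ M) ^ 6   ≤⟨ ^-monoˡ-≤ 6 (^-monoˡ-≤ M (7[1+n]≤n⁵ 2≤n)) ⟩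
    ((n ^ 5) ^ M) ^ 6       ≡⟨ trans (cong (_^ 6) (^-*-assoc n 5 M)) (^-*-assoc n (5 * M) 6) ⟩
    n ^ (5 * M * 6)         ≤⟨ ^-monoʳ-≤ n {{>-nonZero (≤-trans (s≤s z≤n) 2≤n)}} (time-exponent k 1≤k) ⟩
    n ^ (300 * k)           ∎)
    where M = (2 + (k + (k + k))) + (2 + (k + (k + k)))

  size-bound : ∀ {n k} → 2 ≤ n → 1 ≤ k → suc n ^ (2 + (k + (k + k))) ≤ n ^ (300 * k)
  size-bound {n} {k} 2≤n 1≤k = begin
    suc n ^ D       ≤⟨ ^-monoˡ-≤ D (1+n≤n² 2≤n) ⟩
    (n ^ 2) ^ D     ≡⟨ ^-*-assoc n 2 D ⟩
    n ^ (2 * D)     ≤⟨ ^-monoʳ-≤ n {{>-nonZero (≤-trans (s≤s z≤n) 2≤n)}} (size-exponent k 1≤k) ⟩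
    n ^ (300 * k)   ∎
    where D = 2 + (k + (k + k))

-- Finite fields and a rank bound by counting.

module FieldLemmas {c ℓ} (F : FiniteField c ℓ) where

  open FiniteField F hiding (zero) renaming (refl to ≈refl; sym to ≈sym; trans to ≈trans)
  open import Algebra.Properties.Semiring.Sum semiring
  open import Algebra.Properties.Ring ring using (-1*x≈-x)
  open import Data.Empty using (⊥)
  open import Data.Fin using (Fin; zero; suc; finToFun; funToFin; combine)
  open import Data.Fin.Properties as Fin using (pigeonhole; funToFin-finToFin; finToFun-funToFin)
  open import Data.List using (List; []; _∷_; _++_; length)
  open import Data.List.Relation.Binary.Permutation.Propositional using (_↭_; refl; prep; swap; trans)
  open import Data.List.Relation.Binary.Permutation.Propositional.Properties using (↭-length)
  open import Data.Nat as ℕ using (ℕ; zero; suc; _≤_; _<_; z≤n; s≤s; _^_)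
  import Data.Nat.Properties as ℕ
  open import Data.Product using (_,_)
  open import Function using (_∘_)
  open import Function.Bundles using (Inverse)
  open import Relation.Binary.Definitions using (Decidable)
  open import Relation.Binary.PropositionalEquality as ≡ using (_≡_; _≢_)
  open import Relation.Binary.Reasoning.Setoid setoid
  open import Relation.Nullary using (¬_; contradiction)
  open import Relation.Nullary.Decidable using (map′)
  open import Algebra.Solver.Ring.NaturalCoefficients.Default commutativeSemiring using (solve; _:+_; _:*_; _:=_)

  private
    toFin : Carrier → Fin q
    toFin = Inverse.to enumeration

    fromFin : Fin q → Carrier
    fromFin = Inverse.from enumeration

  toFin-injective : ∀ {x y} → toFin x ≡ toFin y → x ≈ y
  toFin-injective {x} {y} e = begin
    x                 ≈⟨ Inverse.strictlyInverseʳ enumeration x ⟨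
    fromFin (toFin x) ≡⟨ ≡.cong fromFin e ⟩
    fromFin (toFin y) ≈⟨ Inverse.strictlyInverseʳ enumeration y ⟩
    y                 ∎

  infix 4 _≟_

  -- Decided by comparing positions in the enumeration. Thanks to this, a value can be shown to
  -- vanish by refuting that it does not, and splitting letters can be searched for.
  _≟_ : Decidable _≈_
  x ≟ y = map′ toFin-injective (Inverse.to-cong enumeration) (toFin x Fin.≟ toFin y)

  1<q : 1 < q
  1<q = two (toFin 0#) (toFin 1#) (0≉1 ∘ toFin-injective)
    where
      two : ∀ {m} (i j : Fin m) → i ≢ j → 1 < m
      two {suc zero}    zero zero i≢j = contradiction ≡.refl i≢j
      two {suc (suc m)} i    j    i≢j = s≤s (s≤s z≤n)

  *-cancelˡ-≉0 : ∀ {x y z} → ¬ (x ≈ 0#) → x * y ≈ x * z → y ≈ z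
  *-cancelˡ-≉0 {x} {y} {z} x≉0 e with inverse x x≉0
  ... | x⁻¹ , xx⁻¹≈1 = begin
    y             ≈⟨ *-identityˡ y ⟨
    1# * y        ≈⟨ *-congʳ xx⁻¹≈1 ⟨
    x * x⁻¹ * y   ≈⟨ rearrange x x⁻¹ y ⟩
    x⁻¹ * (x * y) ≈⟨ *-congˡ e ⟩
    x⁻¹ * (x * z) ≈⟨ rearrange x x⁻¹ z ⟨
    x * x⁻¹ * z   ≈⟨ *-congʳ xx⁻¹≈1 ⟩
    1# * z        ≈⟨ *-identityˡ z ⟩
    z             ∎
    where
      rearrange : ∀ a b c → a * b * c ≈ b * (a * c)
      rearrange = solve 3 (λ a b c → a :* b :* c := b :* (a :* c)) ≈refl

  sum-0 : ∀ {n} {t : Fin n → Carrier} → (∀ i → t i ≈ 0#) → sum t ≈ 0#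
  sum-0 {n} t≈0 = ≈trans (sum-cong-≋ t≈0) (sum-replicate-zero n)

  sum-only : ∀ {n} (t : Fin n → Carrier) i → (∀ j → j ≢ i → t j ≈ 0#) → sum t ≈ t i
  sum-only t zero    t≈0 = begin
    t zero + sum (t ∘ suc) ≈⟨ +-congˡ (sum-0 (λ j → t≈0 (suc j) λ ())) ⟩
    t zero + 0#            ≈⟨ +-identityʳ (t zero) ⟩
    t zero                 ∎
  sum-only t (suc i) t≈0 = begin
    t zero + sum (t ∘ suc) ≈⟨ +-cong (t≈0 zero λ ()) (sum-only (t ∘ suc) i λ j j≢i → t≈0 (suc j) (j≢i ∘ Fin.suc-injective)) ⟩
    0# + t (suc i)         ≈⟨ +-identityˡ (t (suc i)) ⟩
    t (suc i)              ∎

  private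
    funToFin-cong : ∀ {m n} {f g : Fin m → Fin n} → (∀ i → f i ≡ g i) → funToFin f ≡ funToFin g
    funToFin-cong {zero}  e = ≡.refl
    funToFin-cong {suc m} e = ≡.cong₂ combine (e zero) (funToFin-cong (e ∘ suc))

  -- By the pigeonhole principle two of the q^K vectors x have the same image
  -- C x , hence the same image B C x , which determines x as B C is diagonal.
  diagonal-rank : ∀ {r K} → r < K → (B : Fin K → Fin r → Carrier) (C : Fin K → Fin r → Carrier) →
                  (∀ i → ¬ (sum (λ s → B i s * C i s) ≈ 0#)) →
                  (∀ i j → i ≢ j → sum (λ s → B i s * C j s) ≈ 0#) → ⊥
  diagonal-rank {r} {K} r<K B C diag off
    with pigeonhole (ℕ.^-monoʳ-< q 1<q r<K) image
    where
      image : Fin (q ^ K) → Fin (q ^ r)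
      image x = funToFin (λ s → toFin (sum (λ j → C j s * fromFin (finToFun {q} {K} x j))))
  ... | x , y , x<y , e = Fin.<⇒≢ x<y (≡.trans (≡.sym (funToFin-finToFin {K} x))
          (≡.trans (funToFin-cong same) (funToFin-finToFin {K} y)))
    where
      val : Fin (q ^ K) → Fin K → Carrier
      val x j = fromFin (finToFun {q} {K} x j)
      A : Fin K → Fin K → Carrier
      A i j = sum (λ s → B i s * C j s)
      Cx : ∀ s → sum (λ j → C j s * val x j) ≈ sum (λ j → C j s * val y j)
      Cx s = toFin-injective (≡.trans (≡.sym (finToFun-funToFin _ s))
               (≡.trans (≡.cong (λ z → finToFun {q} {r} z s) e) (finToFun-funToFin _ s)))
      factor : ∀ v i → A i i * v i ≈ sum (λ s → B i s * sum (λ j → C j s * v j))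
      factor v i = begin
        A i i * v i
          ≈⟨ sum-only (λ j → A i j * v j) i (λ j j≢i → ≈trans (*-congʳ (off i j (j≢i ∘ ≡.sym))) (zeroˡ (v j))) ⟨
        sum (λ j → A i j * v j)
          ≈⟨ sum-cong-≋ (λ j → *-distribʳ-sum (v j) (λ s → B i s * C j s)) ⟩
        sum (λ j → sum (λ s → B i s * C j s * v j))
          ≈⟨ ∑-comm (λ j s → B i s * C j s * v j) ⟩
        sum (λ s → sum (λ j → B i s * C j s * v j))
          ≈⟨ sum-cong-≋ (λ s → sum-cong-≋ λ j → *-assoc (B i s) (C j s) (v j)) ⟩
        sum (λ s → sum (λ j → B i s * (C j s * v j)))
          ≈⟨ sum-cong-≋ (λ s → *-distribˡ-sum (B i s) (λ j → C j s * v j)) ⟨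
        sum (λ s → B i s * sum (λ j → C j s * v j)) ∎
      same : ∀ i → finToFun {q} {K} x i ≡ finToFun {q} {K} y i
      same i = ≡.trans (≡.sym (Inverse.strictlyInverseˡ enumeration _)) (≡.trans
        (Inverse.to-cong enumeration (*-cancelˡ-≉0 (diag i) (begin
          A i i * val x i                                 ≈⟨ factor (val x) i ⟩
          sum (λ s → B i s * sum (λ j → C j s * val x j)) ≈⟨ sum-cong-≋ (λ s → *-congˡ (Cx s)) ⟩
          sum (λ s → B i s * sum (λ j → C j s * val y j)) ≈⟨ factor (val y) i ⟨
          A i i * val y i                                 ∎)))
        (Inverse.strictlyInverseˡ enumeration _))

  -- Functionals on products of literals.

  data Literal (A : Set) : Set where
    pos neg : A → Literal A

  module _ {A : Set} where

    -- The value of a functional on a product of literals, given its values on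
    -- products of variables; a negative literal stands for 1 − a.
    ext : (List A → Carrier) → List (Literal A) → Carrier
    ext f []          = f []
    ext f (pos a ∷ w) = ext (λ v → f (a ∷ v)) w
    ext f (neg a ∷ w) = ext f w + - 1# * ext (λ v → f (a ∷ v)) w

    -- Agreement is asked for only up to `length w`, as a product of literals expands into monomials
    -- of no larger degree. This is what keeps every use within the degrees in which the rules for
    -- `L` are known.
    ext-cong : ∀ {f g} w → (∀ v → length v ≤ length w → f v ≈ g v) → ext f w ≈ ext g w
    ext-cong []          f≈g = f≈g [] z≤n
    ext-cong (pos a ∷ w) f≈g = ext-cong w (λ v l → f≈g (a ∷ v) (s≤s l))
    ext-cong (neg a ∷ w) f≈g = +-cong (ext-cong w (λ v l → f≈g v (ℕ.m≤n⇒m≤1+n l)))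
                                      (*-congˡ (ext-cong w (λ v l → f≈g (a ∷ v) (s≤s l))))

    ext-++ : ∀ f u v → ext f (u ++ v) ≡ ext (λ x → ext (λ y → f (x ++ y)) v) u
    ext-++ f []          v = ≡.refl
    ext-++ f (pos a ∷ u) v = ext-++ (λ x → f (a ∷ x)) u v
    ext-++ f (neg a ∷ u) v = ≡.cong₂ (λ x y → x + - 1# * y) (ext-++ f u v) (ext-++ (λ x → f (a ∷ x)) u v)

    ext-*ˡ : ∀ b f w → ext (λ v → b * f v) w ≈ b * ext f w
    ext-*ˡ b f []          = ≈refl
    ext-*ˡ b f (pos a ∷ w) = ext-*ˡ b (λ v → f (a ∷ v)) w
    ext-*ˡ b f (neg a ∷ w) = begin
      ext (λ v → b * f v) w + - 1# * ext (λ v → b * f (a ∷ v)) w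
        ≈⟨ +-cong (ext-*ˡ b f w) (*-congˡ (ext-*ˡ b (λ v → f (a ∷ v)) w)) ⟩
      b * ext f w + - 1# * (b * ext (λ v → f (a ∷ v)) w)
        ≈⟨ distribute b _ (- 1#) _ ⟩
      b * (ext f w + - 1# * ext (λ v → f (a ∷ v)) w) ∎
      where
        distribute : ∀ b x m y → b * x + m * (b * y) ≈ b * (x + m * y)
        distribute = solve 4 (λ b x m y → b :* x :+ m :* (b :* y) := b :* (x :+ m :* y)) ≈refl

    ext-*ʳ : ∀ b f w → ext (λ v → f v * b) w ≈ ext f w * b
    ext-*ʳ b f w = begin
      ext (λ v → f v * b) w ≈⟨ ext-cong w (λ v _ → *-comm (f v) b) ⟩
      ext (λ v → b * f v) w ≈⟨ ext-*ˡ b f w ⟩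
      b * ext f w           ≈⟨ *-comm b (ext f w) ⟩
      ext f w * b           ∎

    ext-+ : ∀ f g w → ext (λ v → f v + g v) w ≈ ext f w + ext g w
    ext-+ f g []          = ≈refl
    ext-+ f g (pos a ∷ w) = ext-+ (λ v → f (a ∷ v)) (λ v → g (a ∷ v)) w
    ext-+ f g (neg a ∷ w) = begin
      ext (λ v → f v + g v) w + - 1# * ext (λ v → f (a ∷ v) + g (a ∷ v)) w
        ≈⟨ +-cong (ext-+ f g w) (*-congˡ (ext-+ (λ v → f (a ∷ v)) (λ v → g (a ∷ v)) w)) ⟩
      (ext f w + ext g w) + - 1# * (ext (λ v → f (a ∷ v)) w + ext (λ v → g (a ∷ v)) w)
        ≈⟨ regroup _ _ (- 1#) _ _ ⟩
      ext f (neg a ∷ w) + ext g (neg a ∷ w) ∎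
      where
        regroup : ∀ x y m z u → (x + y) + m * (z + u) ≈ (x + m * z) + (y + m * u)
        regroup = solve 5 (λ x y m z u → (x :+ y) :+ m :* (z :+ u) := (x :+ m :* z) :+ (y :+ m :* u)) ≈refl

    ext-0 : ∀ w → ext (λ _ → 0#) w ≈ 0#
    ext-0 w = begin
      ext (λ _ → 0#) w      ≈⟨ ext-cong w (λ _ _ → zeroˡ 0#) ⟨
      ext (λ _ → 0# * 0#) w ≈⟨ ext-*ˡ 0# (λ _ → 0#) w ⟩
      0# * ext (λ _ → 0#) w ≈⟨ zeroˡ _ ⟩
      0#                    ∎

    ext-sum : ∀ {r} (f : Fin r → List A → Carrier) w → ext (λ v → sum (λ s → f s v)) w ≈ sum (λ s → ext (f s) w)
    ext-sum {zero}  f w = ext-0 w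
    ext-sum {suc r} f w = begin
      ext (λ v → f zero v + sum (λ s → f (suc s) v)) w    ≈⟨ ext-+ (f zero) (λ v → sum (λ s → f (suc s) v)) w ⟩
      ext (f zero) w + ext (λ v → sum (λ s → f (suc s) v)) w ≈⟨ +-congˡ (ext-sum (f ∘ suc) w) ⟩
      ext (f zero) w + sum (λ s → ext (f (suc s)) w)      ∎

    -- By bilinearity, a factorization of the moment matrix on monomials is also one on products of
    -- literals. The orthogonal products can therefore be used as rows and columns in the rank
    -- bound.
    ext-product : ∀ {r} (f : List A → Carrier) (B C : Fin r → List A → Carrier) u v →
                  (∀ x y → length x ≤ length u → length y ≤ length v → f (x ++ y) ≈ sum (λ s → B s x * C s y)) →
                  ext f (u ++ v) ≈ sum (λ s → ext (B s) u * ext (C s) v)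
    ext-product f B C u v f≈BC = begin
      ext f (u ++ v)
        ≡⟨ ext-++ f u v ⟩
      ext (λ x → ext (λ y → f (x ++ y)) v) u
        ≈⟨ ext-cong u (λ x lx → ext-cong v (λ y ly → f≈BC x y lx ly)) ⟩
      ext (λ x → ext (λ y → sum (λ s → B s x * C s y)) v) u
        ≈⟨ ext-cong u (λ x _ → ext-sum (λ s y → B s x * C s y) v) ⟩
      ext (λ x → sum (λ s → ext (λ y → B s x * C s y) v)) u
        ≈⟨ ext-cong u (λ x _ → sum-cong-≋ λ s → ext-*ˡ (B s x) (C s) v) ⟩
      ext (λ x → sum (λ s → B s x * ext (C s) v)) u
        ≈⟨ ext-sum (λ s x → B s x * ext (C s) v) u ⟩
      sum (λ s → ext (λ x → B s x * ext (C s) v) u)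
        ≈⟨ sum-cong-≋ (λ s → ext-*ʳ (ext (C s) v) (B s) u) ⟩
      sum (λ s → ext (B s) u * ext (C s) v) ∎

    Symmetric : ℕ → (List A → Carrier) → Set ℓ
    Symmetric m f = ∀ {u v} → length u ≤ m → u ↭ v → f u ≈ f v

    Idempotent : ℕ → (List A → Carrier) → Set ℓ
    Idempotent m f = ∀ a w → 2 ℕ.+ length w ≤ m → f (a ∷ a ∷ w) ≈ f (a ∷ w)

    ext-swap : ∀ {m f} → Symmetric m f → ∀ x y w → 2 ℕ.+ length w ≤ m → ext f (x ∷ y ∷ w) ≈ ext f (y ∷ x ∷ w)
    ext-swap {m} {f} σ x y w l = swapped x y
      where
        fab≈fba : ∀ a b → ext (λ v → f (a ∷ b ∷ v)) w ≈ ext (λ v → f (b ∷ a ∷ v)) w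
        fab≈fba a b = ext-cong w (λ v lv → σ (ℕ.≤-trans (s≤s (s≤s lv)) l) (swap a b refl))
        regroup : ∀ x y m z u → x + m * y + m * (z + m * u) ≈ x + m * z + m * (y + m * u)
        regroup = solve 5 (λ x y m z u → x :+ m :* y :+ m :* (z :+ m :* u) := x :+ m :* z :+ m :* (y :+ m :* u)) ≈refl
        swapped : ∀ x y → ext f (x ∷ y ∷ w) ≈ ext f (y ∷ x ∷ w)
        swapped (pos a) (pos b) = fab≈fba a b
        swapped (pos a) (neg b) = +-congˡ (*-congˡ (fab≈fba a b))
        swapped (neg a) (pos b) = +-congˡ (*-congˡ (fab≈fba a b))
        swapped (neg a) (neg b) = ≈trans
          (regroup (ext f w) _ (- 1#) (ext (λ v → f (a ∷ v)) w) _)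
          (+-congˡ (*-congˡ (+-congˡ (*-congˡ (fab≈fba a b)))))

    -- The hypothesis ranges over all functionals because taking off `x` replaces `f` by itself and
    -- by `f (a ∷ _)`, the latter symmetric in one degree less.
    ext-∷ : ∀ {m f u v} → Symmetric (suc m) f → (∀ g → Symmetric m g → ext g u ≈ ext g v) →
            ∀ x → ext f (x ∷ u) ≈ ext f (x ∷ v)
    ext-∷ {f = f} σ IH (pos a) = IH (λ v → f (a ∷ v)) (λ l q → σ (s≤s l) (prep a q))
    ext-∷ {f = f} σ IH (neg a) = +-cong (IH f (λ l q → σ (ℕ.m≤n⇒m≤1+n l) q))
                                        (*-congˡ (IH (λ v → f (a ∷ v)) (λ l q → σ (s≤s l) (prep a q))))

    ext-↭ : ∀ {m f u v} → Symmetric m f → length u ≤ m → u ↭ v → ext f u ≈ ext f v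
    ext-↭ σ l       refl         = ≈refl
    ext-↭ σ (s≤s l) (prep x p)   = ext-∷ σ (λ g τ → ext-↭ τ l p) x
    ext-↭ {u = _ ∷ _ ∷ u} σ (s≤s (s≤s l)) (swap x y p) = ≈trans
      (ext-swap σ x y u (s≤s (s≤s l)))
      (ext-∷ σ (λ g τ → ext-∷ τ (λ h υ → ext-↭ υ l p) x) y)
    ext-↭ {f = f} σ l (trans p q) = ≈trans (ext-↭ {f = f} σ l p)
      (ext-↭ {f = f} σ (ℕ.≤-trans (ℕ.≤-reflexive (≡.sym (↭-length p))) l) q)

    private
      x-x≈0 : ∀ {x y} → x ≈ y → x + - 1# * y ≈ 0#
      x-x≈0 {x} {y} x≈y = begin
        x + - 1# * y ≈⟨ +-cong x≈y (-1*x≈-x y) ⟩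
        y + - y      ≈⟨ -‿inverseʳ y ⟩
        0#           ∎

    ext-orthogonal : ∀ {m f} → Idempotent m f → ∀ a w → 2 ℕ.+ length w ≤ m → ext f (pos a ∷ neg a ∷ w) ≈ 0#
    ext-orthogonal {f = f} ι a w l = x-x≈0 (ext-cong w λ v lv → ≈sym (ι a v (ℕ.≤-trans (s≤s (s≤s lv)) l)))

    ext-idempotent : ∀ {m f} → Idempotent m f → ∀ x w → 2 ℕ.+ length w ≤ m → ext f (x ∷ x ∷ w) ≈ ext f (x ∷ w)
    ext-idempotent ι (pos a) w l = ext-cong w λ v lv → ι a v (ℕ.≤-trans (s≤s (s≤s lv)) l)
    -- Here `(1 - a)(1 - a)` is expanded as `(1 - a) - a (1 - a)`, and the last product vanishes.
    ext-idempotent {f = f} ι (neg a) w l = begin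
      ext f (neg a ∷ w) + - 1# * ext f (pos a ∷ neg a ∷ w) ≈⟨ +-congˡ (*-congˡ (ext-orthogonal {f = f} ι a w l)) ⟩
      ext f (neg a ∷ w) + - 1# * 0#                        ≈⟨ +-congˡ (zeroʳ (- 1#)) ⟩
      ext f (neg a ∷ w) + 0#                               ≈⟨ +-identityʳ _ ⟩
      ext f (neg a ∷ w)                                    ∎

-- Pseudo-solutions of low rank vanish on unsatisfiable instances.

module LowRank {c ℓ} (F : FiniteField c ℓ) where

  open FiniteField F hiding (zero) renaming (refl to ≈refl; sym to ≈sym; trans to ≈trans)
  open Over F
  open FieldLemmas F
  open import Algebra.Properties.Ring ring using (-1*x≈-x)
  open import Algebra.Properties.Group +-group using () renaming (x∙y⁻¹≈ε⇒x≈y to x-y≈0⇒x≈y)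
  open import Algebra.Properties.Semiring.Sum semiring
  open import Data.Empty using (⊥)
  open import Data.Fin using (Fin; zero; suc)
  open import Data.Fin.Properties using (any?)
  open import Data.List using (List; []; _∷_; _++_; length; map; take; drop)
  open import Data.List.Membership.Propositional using (_∈_)
  open import Data.List.Membership.Propositional.Properties using (∈-∃++)
  open import Data.List.Properties using (++-assoc; ++-identityʳ; length-++; length-map; length-take; length-drop; take++drop≡id)
  open import Data.List.Relation.Binary.Permutation.Propositional using (_↭_; refl; prep; swap; trans; ↭-sym; ↭-reflexive)
  open import Data.List.Relation.Binary.Permutation.Propositional.Properties using (↭-length; shift; ++⁺; ++⁺ʳ)
  open import Data.List.Relation.Unary.Any using (here; there)
  open import Data.Nat as ℕ using (zero; suc; _≤_; _<_; _∸_; z≤n; s≤s)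
  import Data.Nat.Properties as ℕ
  open import Data.Product using (∃-syntax; _×_; _,_; proj₁; proj₂)
  open import Data.Sum using (_⊎_; inj₁; inj₂)
  open import Data.Vec as Vec using (Vec; []; _∷_)
  open import Data.Vec.Properties using (length-toList)
  open import Function using (_∘_; id)
  open import Relation.Binary.PropositionalEquality as ≡ using (_≡_; _≢_)
  open import Relation.Binary.Reasoning.Setoid setoid
  open import Relation.Nullary using (¬_; yes; no; contradiction; ¬?; Dec; decidable-stable)
  open import Relation.Nullary.Decidable using (_×-dec_)

  private
    ↭-++-∷ : ∀ {A : Set} (u : List A) x v → u ++ x ∷ v ↭ x ∷ u ++ v
    ↭-++-∷ u x v = shift x u v

    ∈⇒↭ : ∀ {A : Set} {x : A} {xs} → x ∈ xs → ∃[ ys ] xs ↭ x ∷ ys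
    ∈⇒↭ x∈xs with ∈-∃++ x∈xs
    ... | ys , zs , ≡.refl = ys ++ zs , shift _ ys zs

    k+[D∸k]⊓x≤D : ∀ {k D} → k ≤ D → ∀ x → k ℕ.+ ((D ∸ k) ℕ.⊓ x) ≤ D
    k+[D∸k]⊓x≤D {k} {D} k≤D x = ≡.subst (k ℕ.+ ((D ∸ k) ℕ.⊓ x) ≤_) (ℕ.m+[n∸m]≡n k≤D)
      (ℕ.+-monoʳ-≤ k (ℕ.m⊓n≤m (D ∸ k) x))

    x∸[D∸k]<D : ∀ {k D} → k ≤ D → ∀ x → suc k ℕ.+ x ≤ D ℕ.+ D → x ∸ (D ∸ k) < D
    x∸[D∸k]<D {k} {suc D} k≤D x l = s≤s (ℕ.m≤n+o⇒m∸n≤o x e (ℕ.+-cancelˡ-≤ k x (e ℕ.+ D)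
      (≡.subst (k ℕ.+ x ≤_) (≡.trans (≡.cong (D ℕ.+_) (≡.sym (ℕ.m+[n∸m]≡n k≤D)))
        (≡.trans (ℕ.+-comm D (k ℕ.+ e)) (ℕ.+-assoc k e D))) (ℕ.s≤s⁻¹ l))))
      where e = suc D ∸ k

    ≤-↭ : ∀ {A : Set} {u v : List A} {m} → u ↭ v → length u ≤ m → length v ≤ m
    ≤-↭ p l = ≡.subst (_≤ _) (↭-length p) l

  lookup∷removeAt : ∀ {A : Set} {k} (xs : Vec A (suc k)) i →
                    Vec.toList xs ↭ Vec.lookup xs i ∷ Vec.toList (Vec.removeAt xs i)
  lookup∷removeAt (x ∷ xs)     zero    = refl
  lookup∷removeAt (x ∷ y ∷ xs) (suc i) =
    trans (prep x (lookup∷removeAt (y ∷ xs) i)) (swap x _ refl)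

  -- The source of the repeated letter off the diagonal in `vanish-minimal`. Positions are
  -- distinguished and not letters, so the word there may itself contain a letter twice.
  removeAt-other : ∀ {A : Set} {k} (xs : Vec A (suc k)) i j → i ≢ j →
                   ∃[ ys ] Vec.toList (Vec.removeAt xs i) ↭ Vec.lookup xs j ∷ ys
  removeAt-other (x ∷ xs)     zero    zero    i≢j = contradiction ≡.refl i≢j
  removeAt-other (x ∷ y ∷ xs) zero    (suc j) i≢j = _ , lookup∷removeAt (y ∷ xs) j
  removeAt-other (x ∷ y ∷ xs) (suc i) zero    i≢j = _ , refl
  removeAt-other (x ∷ y ∷ xs) (suc i) (suc j) i≢j with removeAt-other (y ∷ xs) i j (i≢j ∘ ≡.cong suc)
  ... | ys , p = x ∷ ys , trans (prep x p) (swap x _ refl)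

  prefix : ∀ {A : Set} k (w : List A) → k ≤ length w → ∃[ u ] ∃[ v ] w ≡ Vec.toList {n = k} u ++ v
  prefix zero    w       l       = [] , w , ≡.refl
  prefix (suc k) (x ∷ w) (s≤s l) with prefix k w l
  ... | u , v , ≡.refl = x ∷ u , v , ≡.refl

  -- The polynomial p under the linear map that sends the monomial x_a x_b to E a b.
  apply : ∀ {n} → QuadPoly n → (Fin (suc n) → Fin (suc n) → Carrier) → Carrier
  apply p E = const p * E zero zero
            + sum (λ j → lin p j * E zero (suc j))
            + sum (λ i → sum (λ j → quad p i j * E (suc i) (suc j)))

  apply-cong : ∀ {n} (p : QuadPoly n) {E E′ : Fin (suc n) → Fin (suc n) → Carrier} →
               (∀ a b → E a b ≈ E′ a b) → apply p E ≈ apply p E′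
  apply-cong p E≈E′ = +-cong (+-cong (*-congˡ (E≈E′ zero zero))
    (sum-cong-≋ λ j → *-congˡ (E≈E′ zero (suc j))))
    (sum-cong-≋ λ i → sum-cong-≋ λ j → *-congˡ (E≈E′ (suc i) (suc j)))

  ext-apply : ∀ {A : Set} {n} (p : QuadPoly n) (g : Fin (suc n) → Fin (suc n) → List A → Carrier) w →
              ext (λ v → apply p (λ a b → g a b v)) w ≈ apply p (λ a b → ext (g a b) w)
  ext-apply p g w = ≈trans (ext-+ (λ v → const p * g zero zero v + linear v) quadratic w) (+-cong
      (≈trans (ext-+ (λ v → const p * g zero zero v) linear w) (+-cong (ext-*ˡ (const p) (g zero zero) w)
        (≈trans (ext-sum (λ j v → lin p j * g zero (suc j) v) w)
          (sum-cong-≋ λ j → ext-*ˡ (lin p j) (g zero (suc j)) w))))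
      (≈trans (ext-sum (λ i v → sum (λ j → quad p i j * g (suc i) (suc j) v)) w)
        (sum-cong-≋ λ i → ≈trans (ext-sum (λ j v → quad p i j * g (suc i) (suc j) v) w)
          (sum-cong-≋ λ j → ext-*ˡ (quad p i j) (g (suc i) (suc j)) w))))
    where
      linear    = λ v → sum (λ j → lin p j * g zero (suc j) v)
      quadratic = λ v → sum (λ i → sum (λ j → quad p i j * g (suc i) (suc j) v))

  -- Homogenization: as `x zero` is 1, the letter `zero` fills constant and linear monomials up to
  -- two letters without changing their value.
  apply-eval : ∀ {n} (p : QuadPoly n) (x : Fin (suc n) → Carrier) b → x zero ≈ 1# →
               apply p (λ i j → x i * (x j * b)) ≈ eval p (x ∘ suc) * b
  apply-eval p x b x₀≈1 = ≈sym (begin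
      (const p + sum (λ j → lin p j * x (suc j)) + sum (λ i → sum (λ j → quad p i j * (x (suc i) * x (suc j))))) * b
        ≈⟨ ≈trans (distribʳ b _ _) (+-congʳ (distribʳ b _ _)) ⟩
      const p * b + sum (λ j → lin p j * x (suc j)) * b + sum (λ i → sum (λ j → quad p i j * (x (suc i) * x (suc j)))) * b
        ≈⟨ +-cong (+-cong (*-congˡ (≈sym (≈trans (1* zero) (≈trans (*-congʳ x₀≈1) (*-identityˡ b)))))
             (≈trans (*-distribʳ-sum b (λ j → lin p j * x (suc j)))
               (sum-cong-≋ λ j → ≈trans (*-assoc (lin p j) (x (suc j)) b) (*-congˡ (≈sym (1* (suc j)))))))
             (≈trans (*-distribʳ-sum b (λ i → sum (λ j → quad p i j * (x (suc i) * x (suc j)))))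
               (sum-cong-≋ λ i → ≈trans (*-distribʳ-sum b (λ j → quad p i j * (x (suc i) * x (suc j))))
                 (sum-cong-≋ λ j → ≈trans (*-assoc (quad p i j) (x (suc i) * x (suc j)) b)
                   (*-congˡ (*-assoc (x (suc i)) (x (suc j)) b))))) ⟩
      apply p (λ i j → x i * (x j * b)) ∎)
    where
      1* : ∀ j → x zero * (x j * b) ≈ x j * b
      1* j = ≈trans (*-congʳ x₀≈1) (*-identityˡ (x j * b))

  -- Letters are the variables x₁ , … , xₙ , and zero for the constant 1.  The
  -- functional L is defined on monomials of degree at most 2D, and its moment
  -- matrix L (u ++ v) on monomials u, v of degree at most D factors through
  -- dimension r.
  record PseudoSolution {n m} (f : QuadEq n m) (D r : ℕ) : Set (c ⊔ ℓ) where
    field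
      L          : List (Fin (suc n)) → Carrier
      symmetric  : Symmetric (D ℕ.+ D) L
      idempotent : Idempotent (D ℕ.+ D) L
      unit       : ∀ w → 1 ℕ.+ length w ≤ D ℕ.+ D → L (zero ∷ w) ≈ L w
      annihilate : ∀ s w → 2 ℕ.+ length w ≤ D ℕ.+ D → apply (f s) (λ a b → L (a ∷ b ∷ w)) ≈ 0#
      B C        : Fin r → List (Fin (suc n)) → Carrier
      factor     : ∀ u v → length u ≤ D → length v ≤ D → L (u ++ v) ≈ sum (λ s → B s u * C s v)

  module Vanishing {n m} {f : QuadEq n m} {D r k} (unsat : ¬ Satisfiable f) (r≤k : r ≤ k)
                   (3k≤D : k ℕ.+ (k ℕ.+ k) ≤ D) (P : PseudoSolution f D r) where

    open PseudoSolution P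

    Lit : Set
    Lit = Literal (Fin (suc n))

    M : ℕ
    M = D ℕ.+ D

    L̂ : List Lit → Carrier
    L̂ = ext L

    L̂-↭ : ∀ {u v} → length u ≤ M → u ↭ v → L̂ u ≈ L̂ v
    L̂-↭ = ext-↭ {f = L} symmetric

    L̂-unit : ∀ w → 1 ℕ.+ length w ≤ M → L̂ (pos zero ∷ w) ≈ L̂ w
    L̂-unit w l = ext-cong w λ v lv → unit v (ℕ.≤-trans (s≤s lv) l)

    -- Induction on `e` with `w` arbitrary: once the square of the head is reduced, the head is
    -- moved into `w`. The case of empty `w` gives the diagonal `L̂ (e e) = L̂ e` of the orthogonal
    -- block.
    L̂-absorb : ∀ e w → length (e ++ (e ++ w)) ≤ M → L̂ (e ++ (e ++ w)) ≈ L̂ (e ++ w)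
    L̂-absorb []      w l = ≈refl
    L̂-absorb (x ∷ e) w l = begin
        L̂ (x ∷ e ++ (x ∷ e ++ w))   ≈⟨ L̂-↭ l p₁ ⟩
        L̂ (x ∷ x ∷ e ++ (e ++ w))   ≈⟨ ext-idempotent {f = L} idempotent x (e ++ (e ++ w)) l₁ ⟩
        L̂ (x ∷ e ++ (e ++ w))       ≈⟨ L̂-↭ (ℕ.≤-trans (ℕ.n≤1+n _) l₁) p₂ ⟩
        L̂ (e ++ (e ++ x ∷ w))       ≈⟨ L̂-absorb e (x ∷ w) l₂ ⟩
        L̂ (e ++ x ∷ w)              ≈⟨ L̂-↭ (ℕ.≤-trans (length-++-≤ e) l₂) (↭-++-∷ e x w) ⟩
        L̂ (x ∷ e ++ w)              ∎
      where
        p₁ : x ∷ e ++ (x ∷ e ++ w) ↭ x ∷ x ∷ e ++ (e ++ w)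
        p₁ = prep x (↭-++-∷ e x (e ++ w))
        l₁ = ≤-↭ p₁ l
        p₂ : x ∷ e ++ (e ++ w) ↭ e ++ (e ++ x ∷ w)
        p₂ = ↭-sym (trans (++⁺ (refl {xs = e}) (↭-++-∷ e x w)) (↭-++-∷ e x (e ++ w)))
        l₂ = ≤-↭ p₂ (ℕ.≤-trans (ℕ.n≤1+n _) l₁)
        length-++-≤ : ∀ (u : List Lit) {v} → length v ≤ length (u ++ v)
        length-++-≤ u {v} = ≡.subst (length v ≤_) (≡.sym (length-++ u)) (ℕ.m≤n+m (length v) (length u))

    Opposite : List Lit → List Lit → Set
    Opposite u v = ∃[ a ] ((pos a ∈ u × neg a ∈ v) ⊎ (neg a ∈ u × pos a ∈ v))

    L̂-opposite : ∀ u v → length (u ++ v) ≤ M → Opposite u v → L̂ (u ++ v) ≈ 0#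
    L̂-opposite u v l (a , inj₁ (a∈u , a∈v)) with ∈⇒↭ a∈u | ∈⇒↭ a∈v
    ... | u′ , p | v′ , q = ≈trans (L̂-↭ l π) (ext-orthogonal {f = L} idempotent a (u′ ++ v′) (≤-↭ π l))
      where π = trans (++⁺ p q) (prep (pos a) (↭-++-∷ u′ (neg a) v′))
    L̂-opposite u v l (a , inj₂ (a∈u , a∈v)) with ∈⇒↭ a∈u | ∈⇒↭ a∈v
    ... | u′ , p | v′ , q = ≈trans (L̂-↭ l π) (ext-orthogonal {f = L} idempotent a (u′ ++ v′) (≤-↭ π l))
      where π = trans (++⁺ p q) (trans (prep (neg a) (↭-++-∷ u′ (pos a) v′)) (swap (neg a) (pos a) refl))

    -- The companion letters are part of the notion because `L̂ (x e) = 0` does not by itself give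
    -- `L̂ (x y e) = 0`, which is needed to evaluate quadratic monomials. The companion `zero`
    -- covers the plain products.
    Splits : List Lit → Fin (suc n) → Fin (suc n) → Fin (suc n) → Set ℓ
    Splits e i j j′ = ¬ (L̂ (pos i ∷ pos j ∷ e) ≈ 0#) × ¬ (L̂ (neg i ∷ pos j′ ∷ e) ≈ 0#)

    -- If no variable splits e, then L̂ (p e) = p (a) L̂ (e) for a Boolean point
    -- a and all p of degree at most two, so that a is a solution.
    module Unsplit (e : List Lit) (l : 2 ℕ.+ length e ≤ M) (e≉0 : ¬ (L̂ e ≈ 0#))
                   (unsplit : ∀ i j j′ → ¬ Splits e i j j′) where

      indicator : ∀ {P : Set ℓ} → Dec P → Carrier
      indicator (yes _) = 0#
      indicator (no _)  = 1#

      val : Fin (suc n) → Carrier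
      val i = indicator (L̂ (pos i ∷ e) ≟ 0#)

      unit₁ : L̂ (pos zero ∷ e) ≈ L̂ e
      unit₁ = L̂-unit e (ℕ.≤-trans (ℕ.n≤1+n _) l)

      unit₂ : ∀ i → L̂ (pos i ∷ pos zero ∷ e) ≈ L̂ (pos i ∷ e)
      unit₂ i = ≈trans (L̂-↭ {pos i ∷ pos zero ∷ e} l (swap (pos i) (pos zero) refl)) (L̂-unit (pos i ∷ e) l)

      -- If `L̂ (xᵢ e)` is zero, then `L̂ ((1 - xᵢ) e) = L̂ e` is not, and as `xᵢ` does not split
      -- `e`, `L̂ (xᵢ xⱼ e)` must vanish. If it is not zero, then `L̂ ((1 - xᵢ) xⱼ e)` must vanish.
      -- In both cases `zero` is the companion on the nonzero side.
      val-* : ∀ i j → L̂ (pos i ∷ pos j ∷ e) ≈ val i * L̂ (pos j ∷ e)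
      val-* i j with L̂ (pos i ∷ e) ≟ 0#
      ... | yes i≈0 = ≈trans (decidable-stable (_ ≟ _) λ ij≉0 → unsplit i j zero (ij≉0 , λ z → e≉0 (begin
              L̂ e                                                       ≈⟨ unit₁ ⟨
              L̂ (pos zero ∷ e)                                          ≈⟨ +-identityʳ _ ⟨
              L̂ (pos zero ∷ e) + 0#                                     ≈⟨ +-congˡ (zeroʳ (- 1#)) ⟨
              L̂ (pos zero ∷ e) + - 1# * 0#                              ≈⟨ +-congˡ (*-congˡ (≈trans (unit₂ i) i≈0)) ⟨
              L̂ (pos zero ∷ e) + - 1# * L̂ (pos i ∷ pos zero ∷ e)        ≈⟨ z ⟩
              0#                                                        ∎)))
            (≈sym (zeroˡ _))
      ... | no i≉0 = ≈trans (≈sym (x-y≈0⇒x≈y _ _ (≈trans (+-congˡ (≈sym (-1*x≈-x _)))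
            (decidable-stable (_ ≟ _) λ z → unsplit i zero j (i≉0 ∘ ≈trans (≈sym (unit₂ i)) , z)))))
            (≈sym (*-identityˡ _))

      val-*-* : ∀ i j → L̂ (pos i ∷ pos j ∷ e) ≈ val i * (val j * L̂ e)
      val-*-* i j = ≈trans (val-* i j) (*-congˡ (begin
        L̂ (pos j ∷ e)            ≈⟨ unit₂ j ⟨
        L̂ (pos j ∷ pos zero ∷ e) ≈⟨ val-* j zero ⟩
        val j * L̂ (pos zero ∷ e) ≈⟨ *-congˡ unit₁ ⟩
        val j * L̂ e              ∎))

      val-zero : val zero ≈ 1#
      val-zero with L̂ (pos zero ∷ e) ≟ 0#
      ... | yes z = contradiction (≈trans (≈sym unit₁) z) e≉0
      ... | no  _ = ≈refl

      val-Boolean : ∀ i → val i ≈ 0# ⊎ val i ≈ 1#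
      val-Boolean i with L̂ (pos i ∷ e) ≟ 0#
      ... | yes _ = inj₁ ≈refl
      ... | no  _ = inj₂ ≈refl

      solution : Satisfiable f
      solution = val ∘ suc , val-Boolean ∘ suc , λ s → *-cancelˡ-≉0 e≉0 (begin
          L̂ e * eval (f s) (val ∘ suc)
            ≈⟨ *-comm _ _ ⟩
          eval (f s) (val ∘ suc) * L̂ e
            ≈⟨ apply-eval (f s) val (L̂ e) val-zero ⟨
          apply (f s) (λ i j → val i * (val j * L̂ e))
            ≈⟨ apply-cong (f s) val-*-* ⟨
          apply (f s) (λ i j → L̂ (pos i ∷ pos j ∷ e))
            ≈⟨ ext-apply (f s) (λ i j w → L (i ∷ j ∷ w)) e ⟨
          ext (λ w → apply (f s) (λ i j → L (i ∷ j ∷ w))) e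
            ≈⟨ ext-cong e (λ w lw → annihilate s w (ℕ.≤-trans (s≤s (s≤s lw)) l)) ⟩
          ext (λ _ → 0#) e
            ≈⟨ ext-0 e ⟩
          0#
            ≈⟨ zeroʳ _ ⟨
          L̂ e * 0# ∎)

    split : ∀ e → 2 ℕ.+ length e ≤ M → ¬ (L̂ e ≈ 0#) → ∃[ i ] ∃[ j ] ∃[ j′ ] Splits e i j j′
    split e l e≉0 with any? (λ i → any? λ j → any? λ j′ →
      ¬? (L̂ (pos i ∷ pos j ∷ e) ≟ 0#) ×-dec ¬? (L̂ (neg i ∷ pos j′ ∷ e) ≟ 0#))
    ... | yes p = p
    ... | no ¬p = contradiction (Unsplit.solution e l e≉0 λ i j j′ p → ¬p (i , j , j′ , p)) unsat

    -- `extends` serves the recursion: a literal added to `e` beforehand occurs in every member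
    -- obtained for the larger product, so one further product with the negated literal is opposite
    -- to all of them.
    record Orthogonal (j : ℕ) (e : List Lit) : Set ℓ where
      field
        member   : Fin (suc j) → List Lit
        short    : ∀ i → length (member i) ≤ D
        nonzero  : ∀ i → ¬ (L̂ (member i) ≈ 0#)
        extends  : ∀ i {x} → x ∈ e → x ∈ member i
        opposite : ∀ i i′ → i ≢ i′ → Opposite (member i) (member i′)

    D≤M : D ≤ M
    D≤M = ℕ.m≤m+n D D

    -- A path of splittings and not a full tree: the negative product is kept as a member, and only
    -- the positive one is split again. Each step yields one more member for two more letters,
    -- whence the `j + j`.
    orthogonal : ∀ j e → length e ℕ.+ (j ℕ.+ j) ≤ D → ¬ (L̂ e ≈ 0#) → Orthogonal j e
    orthogonal zero    e l e≉0 = record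
      { member   = λ _ → e
      ; short    = λ _ → ≡.subst (_≤ D) (ℕ.+-identityʳ (length e)) l
      ; nonzero  = λ _ → e≉0
      ; extends  = λ _ → id
      ; opposite = λ { zero zero i≢i′ → contradiction ≡.refl i≢i′ }
      }
    orthogonal (suc j) e l e≉0 = record
      { member   = λ { zero → neg a ∷ pos b′ ∷ e ; (suc i) → member i }
      ; short    = λ { zero → ℕ.≤-trans (ℕ.m≤m+n _ (j ℕ.+ j)) l′ ; (suc i) → short i }
      ; nonzero  = λ { zero → proj₂ ab≉0 ; (suc i) → nonzero i }
      ; extends  = λ { zero x∈e → there (there x∈e) ; (suc i) x∈e → extends i (there (there x∈e)) }
      ; opposite = λ
        { zero    zero     i≢i′ → contradiction ≡.refl i≢i′
        ; zero    (suc i′) i≢i′ → a , inj₂ (here ≡.refl , extends i′ (here ≡.refl))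
        ; (suc i) zero     i≢i′ → a , inj₁ (extends i (here ≡.refl) , here ≡.refl)
        ; (suc i) (suc i′) i≢i′ → opposite i i′ (i≢i′ ∘ ≡.cong suc)
        }
      }
      where
        l′ : 2 ℕ.+ length e ℕ.+ (j ℕ.+ j) ≤ D
        l′ = ≡.subst (_≤ D) (≡.trans (≡.cong (length e ℕ.+_) (≡.cong suc (ℕ.+-suc j j)))
               (≡.trans (ℕ.+-suc (length e) _) (≡.cong suc (ℕ.+-suc (length e) _)))) l
        s = split e (ℕ.≤-trans (ℕ.m≤m+n _ (j ℕ.+ j)) (ℕ.≤-trans l′ D≤M)) e≉0
        a = proj₁ s
        b = proj₁ (proj₂ s)
        b′ = proj₁ (proj₂ (proj₂ s))
        ab≉0 = proj₂ (proj₂ (proj₂ s))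
        open Orthogonal (orthogonal j (pos a ∷ pos b ∷ e) l′ (proj₁ ab≉0))

    private
      ++-≤M : ∀ {A : Set} (u v : List A) → length u ≤ D → length v ≤ D → length (u ++ v) ≤ M
      ++-≤M u v lu lv = ≡.subst (_≤ M) (≡.sym (length-++ u)) (ℕ.+-mono-≤ lu lv)

    Orthogonal⇒⊥ : ∀ {e} → Orthogonal k e → ⊥
    Orthogonal⇒⊥ O = diagonal-rank (s≤s r≤k) (λ i s → ext (B s) (member i)) (λ i s → ext (C s) (member i))
        (λ i z → nonzero i (begin
          L̂ (member i)               ≡⟨ ≡.cong L̂ (++-identityʳ (member i)) ⟨
          L̂ (member i ++ [])         ≈⟨ L̂-absorb (member i) [] (≡.subst (λ v → length (member i ++ v) ≤ M)
                                          (≡.sym (++-identityʳ (member i))) (++-≤M (member i) (member i) (short i) (short i))) ⟨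
          L̂ (member i ++ (member i ++ [])) ≡⟨ ≡.cong (λ v → L̂ (member i ++ v)) (++-identityʳ (member i)) ⟩
          L̂ (member i ++ member i)   ≈⟨ product i i ⟩
          sum (λ s → ext (B s) (member i) * ext (C s) (member i)) ≈⟨ z ⟩
          0# ∎))
        (λ i j i≢j → ≈trans (≈sym (product i j))
          (L̂-opposite (member i) (member j) (++-≤M (member i) (member j) (short i) (short j)) (opposite i j i≢j)))
      where
        open Orthogonal O
        product : ∀ i j → L̂ (member i ++ member j) ≈ sum (λ s → ext (B s) (member i) * ext (C s) (member j))
        product i j = ext-product L B C (member i) (member j) λ x y lx ly →
          factor x y (ℕ.≤-trans lx (short i)) (ℕ.≤-trans ly (short j))

    ext-map-pos : ∀ (g : List (Fin (suc n)) → Carrier) w → ext g (map pos w) ≡ g w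
    ext-map-pos g []      = ≡.refl
    ext-map-pos g (a ∷ w) = ext-map-pos (λ v → g (a ∷ v)) w

    vanish-short : ∀ w → length w ≤ k → L w ≈ 0#
    vanish-short w l = decidable-stable (_ ≟ _) λ w≉0 → Orthogonal⇒⊥ (orthogonal k (map pos w)
      (ℕ.≤-trans (ℕ.+-monoˡ-≤ (k ℕ.+ k) (≡.subst (_≤ k) (≡.sym (length-map pos w)) l)) 3k≤D)
      (≡.subst (λ x → ¬ (x ≈ 0#)) (≡.sym (ext-map-pos L w)) w≉0))

    -- Let w = a₀ ⋯ aₖ R C.  The products of a monomial ∏ {aₗ : l ≠ i} R with a
    -- monomial aⱼ C have smaller degree for i ≠ j, since aⱼ is repeated; hence
    -- the corresponding block of the moment matrix is L w times an identity.
    vanish-minimal : ∀ w → (∀ v → length v < length w → L v ≈ 0#) →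
                     k < length w → length w ≤ M → L w ≈ 0#
    vanish-minimal w minimal k<w w≤M with prefix (suc k) w k<w
    ... | as , rest , ≡.refl = decidable-stable (_ ≟ _) λ w≉0 →
        diagonal-rank (s≤s r≤k) (λ i s → B s (row i)) (λ j s → C s (col j))
          (λ i z → w≉0 (≈trans (symmetric w≤M (diag i)) (≈trans (≈sym (L-↭ (arrange i i) (≤-↭ (diag i) w≤M)))
             (≈trans (factor (row i) (col i) (row≤D i) (col≤D i)) z))))
          (λ i j i≢j → ≈trans (≈sym (factor (row i) (col j) (row≤D i) (col≤D j))) (off i j i≢j))
      where
        -- A row already holds `k` of the chosen letters, so `D ∸ k` more fill it up. What is left,
        -- together with one chosen letter, fits into a column since the whole word has length at
        -- most `2D`.
        R  = take (D ∸ k) rest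
        Cᵣ = drop (D ∸ k) rest
        row : Fin (suc k) → List (Fin (suc n))
        row i = Vec.toList (Vec.removeAt as i) ++ R
        col : Fin (suc k) → List (Fin (suc n))
        col j = Vec.lookup as j ∷ Cᵣ
        k≤D : k ≤ D
        k≤D = ℕ.≤-trans (ℕ.m≤m+n k (k ℕ.+ k)) 3k≤D
        row≤D : ∀ i → length (row i) ≤ D
        row≤D i = ≡.subst (_≤ D)
          (≡.sym (≡.trans (length-++ (Vec.toList (Vec.removeAt as i)))
            (≡.cong₂ ℕ._+_ (length-toList (Vec.removeAt as i)) (length-take (D ∸ k) rest))))
          (k+[D∸k]⊓x≤D k≤D (length rest))
        col≤D : ∀ j → length (col j) ≤ D
        col≤D j = ≡.subst (_≤ D) (≡.cong suc (≡.sym (length-drop (D ∸ k) rest)))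
          (x∸[D∸k]<D k≤D (length rest) (≡.subst (_≤ M)
            (≡.trans (length-++ (Vec.toList as)) (≡.cong (ℕ._+ length rest) (length-toList as))) w≤M))
        L-↭ : ∀ {u v} → u ↭ v → length v ≤ M → L u ≈ L v
        L-↭ p l = ≈sym (symmetric l (↭-sym p))
        arrange : ∀ i j → row i ++ col j ↭ Vec.lookup as j ∷ Vec.toList (Vec.removeAt as i) ++ rest
        arrange i j = trans (↭-++-∷ (row i) _ Cᵣ) (prep _ (↭-reflexive
          (≡.trans (++-assoc (Vec.toList (Vec.removeAt as i)) R Cᵣ)
                   (≡.cong (Vec.toList (Vec.removeAt as i) ++_) (take++drop≡id (D ∸ k) rest)))))
        diag : ∀ i → Vec.toList as ++ rest ↭ Vec.lookup as i ∷ Vec.toList (Vec.removeAt as i) ++ rest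
        diag i = ++⁺ʳ rest (lookup∷removeAt as i)
        off : ∀ i j → i ≢ j → L (row i ++ col j) ≈ 0#
        off i j i≢j with removeAt-other as i j i≢j
        ... | ys , p = ≈trans (L-↭ π l) (≈trans (idempotent _ (ys ++ rest) l) (minimal _ (ℕ.≤-reflexive len)))
          where
            a = Vec.lookup as j
            π : row i ++ col j ↭ a ∷ a ∷ ys ++ rest
            π = trans (arrange i j) (prep a (++⁺ʳ rest p))
            len : length (a ∷ a ∷ ys ++ rest) ≡ length (Vec.toList as ++ rest)
            len = ≡.sym (↭-length (trans (diag i) (prep _ (++⁺ʳ rest p))))
            l : length (a ∷ a ∷ ys ++ rest) ≤ M
            l = ≡.subst (_≤ M) (≡.sym len) w≤M

    vanish : ∀ w → length w ≤ M → L w ≈ 0#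
    vanish w = below (length w) w ℕ.≤-refl
      where
        below : ∀ b w → length w ≤ b → length w ≤ M → L w ≈ 0#
        below zero    w l l′ = vanish-short w (ℕ.≤-trans l z≤n)
        below (suc b) w l l′ with length w ℕ.≤? k
        ... | yes w≤k = vanish-short w w≤k
        ... | no  w≰k = vanish-minimal w
          (λ v v<w → below b v (ℕ.s≤s⁻¹ (ℕ.≤-trans v<w l)) (ℕ.≤-trans (ℕ.<⇒≤ v<w) l′)) (ℕ.≰⇒> w≰k) l′

-- The linear system, and that the program writes it.

module Reduction {c ℓ} (F : FiniteField c ℓ) (k : ℕ) where

  open Machine
  open Encoding
  open Time using (time≤; time-bound)
  open FiniteField F hiding (zero) renaming (refl to ≈refl; sym to ≈sym; trans to ≈trans)
  open Over F
  open import Data.Bool using (Bool; true; false; if_then_else_)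
  open import Data.Fin using (Fin; zero; suc; toℕ; combine; splitAt; quotient; remainder; _↑ˡ_; _↑ʳ_)
  open import Data.Fin.Properties using (remQuot-combine; splitAt-↑ˡ; splitAt-↑ʳ; toℕ<n)
  open import Data.List using (List; _∷_; _++_; [_]; concat; tabulate; length)
  open import Data.List.Properties using (length-++; length-tabulate)
  open import Data.Nat as ℕ using (zero; suc; _≤_; _<_; _^_; z≤n; s≤s)
  import Data.Nat.Properties as ℕ
  open import Data.Product using (∃-syntax; _×_; _,_)
  open import Data.Sum using (_⊎_; inj₁; inj₂)
  open import Data.Vec as Vec using (Vec; _∷_)
  open import Data.Vec.Properties using (map-++)
  open import Relation.Binary.PropositionalEquality as ≡ using (_≡_)
  open ≡.≡-Reasoning

  -- Monomials x_S with |S| ≤ k times k pairs of literals have degree at most 3k.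
  D m : ℕ
  D = 2 ℕ.+ (k ℕ.+ (k ℕ.+ k))
  m = k ℕ.+ (k ℕ.+ k) ℕ.+ D

  open Generator D m (code 0#) (code 1#) (code (- 1#)) hiding (template) public

  module _ {n r : ℕ} (f : QuadEq n r) where

    B N : ℕ
    B = suc n
    N = B ^ D

    Word : ℕ → Set
    Word = Vec (Fin B)

    same : ∀ {d} → Word d → Word d → Bool
    same u v = eqs (Vec.map toℕ u) (Vec.map toℕ v)

    monomial-coeff : QuadPoly n → Fin B → Fin B → Carrier
    monomial-coeff p zero    zero    = const p
    monomial-coeff p zero    (suc j) = lin p j
    monomial-coeff p (suc i) zero    = 0#
    monomial-coeff p (suc i) (suc j) = quad p i j

    signed : ∀ {d} → Word d → Word d → Word d → Carrier
    signed u v w = if same w u then (if same w v then 0# else 1#) else (if same w v then - 1# else 0#)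

    located : ∀ {d} → QuadPoly n → Word (2 ℕ.+ d) → Word (2 ℕ.+ d) → Carrier
    located p (_ ∷ _ ∷ u) (a ∷ b ∷ w) = if same w u then monomial-coeff p a b else 0#

    Family : Set
    Family = Fin (suc M) ⊎ Fin r

    -- With L (v) the entry of the matrix at the word v, the equation of inj₂ s and
    -- a ∷ b ∷ u is L (fₛ · u) = 0 ; the letters a and b are not used.
    weight : Family → Word M → Word M → Carrier
    weight (inj₁ t) u = signed (lhs t zero u) (rhs t zero u)
    weight (inj₂ s) u = located (f s) u

    -- Equations are numbered by family first and word second, the order in which the program writes
    -- them.
    system : LinearSystem N
    size  system = (suc M ℕ.+ r) ℕ.* B ^ M
    coeff system e i j = weight (splitAt (suc M) (quotient {suc M ℕ.+ r} (B ^ M) e))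
      (digits M (remainder {suc M ℕ.+ r} (B ^ M) e)) (digits D i Vec.++ digits D j)

    -- Since `M` unfolds to `D + D`, the nest over the words of an entry breaks up into a nest over
    -- rows and one over columns.
    encodeMatrix-digits : (K : Word M → Carrier) (g : Vec ℕ M → List ℕ) → (∀ w → g (Vec.map toℕ w) ≡ [ code (K w) ]) →
      encodeMatrix {N} {N} (λ i j → K (digits D i Vec.++ digits D j)) ≡ nestOut B M g
    encodeMatrix-digits K g e = ≡.trans
      (≡.trans (concat-tabulate-cong {a = N} (λ i → ≡.sym (concat-tabulate-[] {a = N} (λ j → code (K (digits D i Vec.++ digits D j))))))
        (≡.trans (concat-tabulate-cong {a = N} (λ i → tabulate-digits D {λ v → g (Vec.map toℕ (digits D i) Vec.++ v)}
            {λ v → [ code (K (digits D i Vec.++ v)) ]}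
            (λ v → ≡.trans (≡.cong g (≡.sym (map-++ toℕ (digits D i) v))) (e (digits D i Vec.++ v)))))
          (tabulate-digits D {λ u → nestOut B D (λ v → g (u Vec.++ v))}
            {λ u → nestOut B D (λ v → g (Vec.map toℕ u Vec.++ v))} (λ u → ≡.refl))))
      (≡.sym (nestOut-++ B D g))

    input : List ℕ
    input = encodeInstance f

    signOut-code : ∀ {d} (u v w : Word d) →
      signOut (code 0#) (code 1#) (code (- 1#)) (Vec.map toℕ u) (Vec.map toℕ v) (Vec.map toℕ w) ≡ [ code (signed u v w) ]
    signOut-code u v w with same w u | same w v
    ... | true  | true  = ≡.refl
    ... | true  | false = ≡.refl
    ... | false | true  = ≡.refl
    ... | false | false = ≡.refl

    length-encodeMatrix : ∀ {a b} (X : Matrix a b) → length (encodeMatrix X) ≡ a ℕ.* b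
    length-encodeMatrix X = length-concat-tabulate (λ i → encodeVector (X i)) (λ i → length-tabulate (λ j → code (X i j)))

    polyLength : ℕ
    polyLength = suc n ℕ.+ n ℕ.* n

    length-encodePoly : ∀ p → length (encodePoly {n} p) ≡ polyLength
    length-encodePoly p = ≡.cong suc (≡.trans (length-++ (encodeVector (lin p)))
      (≡.cong₂ ℕ._+_ (length-tabulate (λ i → code (lin p i))) (length-encodeMatrix (quad p))))

    nth-input : ∀ s {x} → x < polyLength → nth input (x ℕ.+ (2 ℕ.+ toℕ s ℕ.* polyLength)) ≡ nth (encodePoly (f s)) x
    nth-input s {x} l = ≡.trans (≡.cong (nth input) (ℕ.+-comm x (2 ℕ.+ toℕ s ℕ.* polyLength)))
      (nth-concat-tabulate (λ s → encodePoly (f s)) (λ s → length-encodePoly (f s)) s l)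

    entryOut-code : ∀ s a b →
      entryOut (code 0#) (code 1#) (code (- 1#)) (nth input) n (2 ℕ.+ toℕ s ℕ.* polyLength) (toℕ a) (toℕ b)
        ≡ [ code (monomial-coeff (f s) a b) ]
    entryOut-code s zero zero = ≡.cong [_] (≡.trans
      (≡.cong (λ x → nth input (x ℕ.+ 0 ℕ.+ (2 ℕ.+ toℕ s ℕ.* polyLength))) (ℕ.*-zeroʳ n))
      (nth-input s (s≤s z≤n)))
    entryOut-code s zero (suc j) = ≡.cong [_] (≡.trans
      (≡.cong (λ x → nth input (x ℕ.+ suc (toℕ j) ℕ.+ (2 ℕ.+ toℕ s ℕ.* polyLength))) (ℕ.*-zeroʳ n))
      (≡.trans (nth-input s (s≤s (ℕ.≤-trans (toℕ<n j) (ℕ.m≤m+n n (n ℕ.* n)))))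
        (≡.trans (nth-++ˡ (encodeVector (lin (f s))) (encodeMatrix (quad (f s)))
            (≡.subst (toℕ j <_) (≡.sym (length-tabulate (λ i → code (lin (f s) i)))) (toℕ<n j)))
          (nth-tabulate (λ i → code (lin (f s) i)) j))))
    entryOut-code s (suc i) zero    = ≡.refl
    entryOut-code s (suc i) (suc j) = ≡.cong [_] (begin
      nth input (n ℕ.* suc (toℕ i) ℕ.+ suc (toℕ j) ℕ.+ (2 ℕ.+ toℕ s ℕ.* polyLength))
        ≡⟨ ≡.cong (λ x → nth input (x ℕ.+ (2 ℕ.+ toℕ s ℕ.* polyLength))) position ⟩
      nth input (suc (n ℕ.+ (toℕ i ℕ.* n ℕ.+ toℕ j)) ℕ.+ (2 ℕ.+ toℕ s ℕ.* polyLength))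
        ≡⟨ nth-input s (s≤s (ℕ.+-monoʳ-< n within)) ⟩
      nth (encodeVector (lin (f s)) ++ encodeMatrix (quad (f s))) (n ℕ.+ (toℕ i ℕ.* n ℕ.+ toℕ j))
        ≡⟨ ≡.cong (λ l → nth (encodeVector (lin (f s)) ++ encodeMatrix (quad (f s))) (l ℕ.+ (toℕ i ℕ.* n ℕ.+ toℕ j)))
             (length-tabulate (λ i → code (lin (f s) i))) ⟨
      nth (encodeVector (lin (f s)) ++ encodeMatrix (quad (f s)))
        (length (encodeVector (lin (f s))) ℕ.+ (toℕ i ℕ.* n ℕ.+ toℕ j))
        ≡⟨ nth-++ʳ (encodeVector (lin (f s))) (encodeMatrix (quad (f s))) (toℕ i ℕ.* n ℕ.+ toℕ j) ⟩
      nth (encodeMatrix (quad (f s))) (toℕ i ℕ.* n ℕ.+ toℕ j)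
        ≡⟨ nth-concat-tabulate (λ i → encodeVector (quad (f s) i)) (λ i → length-tabulate (λ j → code (quad (f s) i j))) i (toℕ<n j) ⟩
      nth (encodeVector (quad (f s) i)) (toℕ j)
        ≡⟨ nth-tabulate (λ j → code (quad (f s) i j)) j ⟩
      code (quad (f s) i j) ∎)
      where
        position : n ℕ.* suc (toℕ i) ℕ.+ suc (toℕ j) ≡ suc (n ℕ.+ (toℕ i ℕ.* n ℕ.+ toℕ j))
        position = ≡.trans (ℕ.+-suc (n ℕ.* suc (toℕ i)) (toℕ j)) (≡.cong suc (≡.trans
          (≡.cong (ℕ._+ toℕ j) (ℕ.*-comm n (suc (toℕ i)))) (ℕ.+-assoc n (toℕ i ℕ.* n) (toℕ j))))
        within : toℕ i ℕ.* n ℕ.+ toℕ j < n ℕ.* n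
        within = ℕ.<-≤-trans (ℕ.+-monoʳ-< (toℕ i ℕ.* n) (toℕ<n j))
          (≡.subst (ℕ._≤ n ℕ.* n) (ℕ.+-comm n (toℕ i ℕ.* n)) (ℕ.*-monoˡ-≤ n (toℕ<n i)))

    polyOut-code : ∀ s (u w : Word M) →
      polyOut (nth input) n (2 ℕ.+ toℕ s ℕ.* polyLength) (Vec.map toℕ u) (Vec.map toℕ w) ≡ [ code (located (f s) u w) ]
    polyOut-code s (_ ∷ _ ∷ u) (a ∷ b ∷ w) with same w u
    ... | true  = entryOut-code s a b
    ... | false = ≡.refl

    familyOut : Family → Vec ℕ M → Vec ℕ M → List ℕ
    familyOut (inj₁ t) e = signOut (code 0#) (code 1#) (code (- 1#)) (lhs t 0 e) (rhs t 0 e)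
    familyOut (inj₂ s) e = polyOut (nth input) n (2 ℕ.+ toℕ s ℕ.* polyLength) e

    familyOut-code : ∀ φ u w → familyOut φ (Vec.map toℕ u) (Vec.map toℕ w) ≡ [ code (weight φ u w) ]
    familyOut-code (inj₁ t) u w = ≡.trans
      (≡.cong₂ (λ x y → signOut (code 0#) (code 1#) (code (- 1#)) x y (Vec.map toℕ w))
        (≡.sym (map-lhs toℕ zero t u)) (≡.sym (map-rhs toℕ zero t u)))
      (signOut-code (lhs t zero u) (rhs t zero u) w)
    familyOut-code (inj₂ s) u w = polyOut-code s u w

    coeff-combine : ∀ φ (i : Fin (B ^ M)) →
      encodeMatrix (coeff system (combine {suc M ℕ.+ r} φ i))
      ≡ encodeMatrix {N} {N} (λ x y → weight (splitAt (suc M) φ) (digits M i) (digits D x Vec.++ digits D y))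
    coeff-combine φ i = ≡.cong (λ (φ , i) →
        encodeMatrix {N} {N} (λ x y → weight (splitAt (suc M) φ) (digits M i) (digits D x Vec.++ digits D y)))
      (remQuot-combine φ i)

    encode-family : ∀ φ →
      concat (tabulate (λ i → encodeMatrix {N} {N} (λ x y → weight φ (digits M i) (digits D x Vec.++ digits D y))))
      ≡ squareOut B M (familyOut φ)
    encode-family φ = tabulate-digits M {λ e → nestOut B M (familyOut φ e)}
      {λ u → encodeMatrix {N} {N} (λ x y → weight φ u (digits D x Vec.++ digits D y))}
      (λ u → ≡.sym (encodeMatrix-digits (weight φ u) (familyOut φ (Vec.map toℕ u)) (familyOut-code φ u)))

    encode-system : encodeSystem system ≡ outputOf n r (concat (tabulate (λ s → encodePoly (f s))))
    encode-system = ≡.cong₂ (λ x y → N ∷ x ∷ y) (ℕ.*-comm (suc M ℕ.+ r) (B ^ M)) (begin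
      concat (tabulate (λ e → encodeMatrix (coeff system e)))
        ≡⟨ concat-tabulate-* (suc M ℕ.+ r) (B ^ M) (λ e → encodeMatrix (coeff system e)) ⟩
      concat (tabulate {n = suc M ℕ.+ r} (λ φ → concat (tabulate {n = B ^ M} (λ i → encodeMatrix (coeff system (combine φ i))))))
        ≡⟨ concat-tabulate-cong {a = suc M ℕ.+ r} (λ φ → concat-tabulate-cong {a = B ^ M} (λ i → coeff-combine φ i)) ⟩
      concat (tabulate {n = suc M ℕ.+ r} (λ φ → concat (tabulate {n = B ^ M} (λ i →
        encodeMatrix {N} {N} (λ x y → weight (splitAt (suc M) φ) (digits M i) (digits D x Vec.++ digits D y))))))
        ≡⟨ concat-tabulate-cong {a = suc M ℕ.+ r} (λ φ → encode-family (splitAt (suc M) φ)) ⟩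
      concat (tabulate {n = suc M ℕ.+ r} (λ φ → squareOut B M (familyOut (splitAt (suc M) φ))))
        ≡⟨ concat-tabulate-+ (suc M) r (λ φ → squareOut B M (familyOut (splitAt (suc M) φ))) ⟩
      concat (tabulate {n = suc M} (λ t → squareOut B M (familyOut (splitAt (suc M) (t ↑ˡ r))))) ++
      concat (tabulate {n = r} (λ s → squareOut B M (familyOut (splitAt (suc M) (suc M ↑ʳ s)))))
        ≡⟨ ≡.cong₂ _++_
             (concat-tabulate-cong {a = suc M} (λ t → ≡.cong (λ φ → squareOut B M (familyOut φ)) (splitAt-↑ˡ (suc M) t r)))
             (concat-tabulate-cong {a = r} (λ s → ≡.cong (λ φ → squareOut B M (familyOut φ)) (splitAt-↑ʳ (suc M) r s))) ⟩
      concat (tabulate (templateOut B)) ++ concat (tabulate {n = r} (λ s → squareOut B M (familyOut (inj₂ s))))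
        ≡⟨ ≡.cong (concat (tabulate (templateOut B)) ++_)
             (progression-tabulate (λ b → squareOut B M (polyOut (nth input) n b)) polyLength r 2) ⟨
      concat (tabulate (templateOut B)) ++ progression (λ b → squareOut B M (polyOut (nth input) n b)) polyLength r 2 ∎)

    computes : ∃[ t ] Computes program input (encodeSystem system) t × (2 ≤ n → 1 ≤ k → t ≤ suc r ℕ.* n ^ (300 ℕ.* k))
    computes = steps , (final , halts , ≡.trans output (≡.sym encode-system)) , λ 2≤n 1≤k →
        ℕ.≤-trans steps≤ (ℕ.≤-trans (time≤ D m (code 0#) (code 1#) (code (- 1#)) n r (ℕ.m≤m+n D D))
          (time-bound {n} {r} {k} 2≤n 1≤k))
      where open Runs (programᴿ n r (concat (tabulate (λ s → encodePoly (f s)))))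

-- Sums over words.

module WordSums {c ℓ} (F : FiniteField c ℓ) (B : ℕ) where

  open Machine
  open Encoding
  open FiniteField F hiding (zero) renaming (refl to ≈refl; sym to ≈sym; trans to ≈trans)
  open FieldLemmas F
  open import Algebra.Properties.Semiring.Sum semiring
  open import Data.Bool using (if_then_else_; _∧_)
  open import Data.Fin using (Fin; zero; suc; toℕ; combine; _↑ˡ_; _↑ʳ_)
  open import Data.Fin.Properties using (toℕ-injective)
  open import Data.Nat as ℕ using (ℕ; zero; suc; _^_)
  import Data.Nat.Properties as ℕ
  open import Data.Vec as Vec using (Vec; []; _∷_)
  open import Function using (_∘_)
  open import Relation.Binary.PropositionalEquality as ≡ using (_≡_)
  open import Relation.Binary.Reasoning.Setoid setoid
  open import Relation.Nullary.Decidable using (dec-true; dec-false)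

  sum-+ : ∀ a b (t : Fin (a ℕ.+ b) → Carrier) →
          sum t ≈ sum (λ i → t (i ↑ˡ b)) + sum (λ j → t (a ↑ʳ j))
  sum-+ zero    b t = ≈sym (+-identityˡ _)
  sum-+ (suc a) b t = ≈trans (+-congˡ (sum-+ a b (t ∘ suc))) (≈sym (+-assoc _ _ _))

  sum-* : ∀ a b (t : Fin (a ℕ.* b) → Carrier) → sum t ≈ sum (λ i → sum (λ j → t (combine {a} {b} i j)))
  sum-* zero    b t = ≈refl
  sum-* (suc a) b t = ≈trans (sum-+ b (a ℕ.* b) t) (+-congˡ (sum-* a b (λ i → t (b ↑ʳ i))))

  Word : ℕ → Set
  Word = Vec (Fin B)

  sumW : ∀ d → (Word d → Carrier) → Carrier
  sumW zero    φ = φ []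
  sumW (suc d) φ = sum (λ a → sumW d (λ w → φ (a ∷ w)))

  sumW-cong : ∀ d {φ ψ : Word d → Carrier} → (∀ w → φ w ≈ ψ w) → sumW d φ ≈ sumW d ψ
  sumW-cong zero    e = e []
  sumW-cong (suc d) e = sum-cong-≋ (λ a → sumW-cong d (λ w → e (a ∷ w)))

  sumW-++ : ∀ d {d′} (φ : Word (d ℕ.+ d′) → Carrier) →
            sumW (d ℕ.+ d′) φ ≈ sumW d (λ u → sumW d′ (λ v → φ (u Vec.++ v)))
  sumW-++ zero    φ = ≈refl
  sumW-++ (suc d) φ = sum-cong-≋ (λ a → sumW-++ d (λ w → φ (a ∷ w)))

  sumW-+ : ∀ d (φ ψ : Word d → Carrier) → sumW d (λ w → φ w + ψ w) ≈ sumW d φ + sumW d ψ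
  sumW-+ zero    φ ψ = ≈refl
  sumW-+ (suc d) φ ψ = ≈trans (sum-cong-≋ (λ a → sumW-+ d (λ w → φ (a ∷ w)) (λ w → ψ (a ∷ w))))
    (∑-distrib-+ (λ a → sumW d (λ w → φ (a ∷ w))) (λ a → sumW d (λ w → ψ (a ∷ w))))

  sumW-*ˡ : ∀ d x (φ : Word d → Carrier) → sumW d (λ w → x * φ w) ≈ x * sumW d φ
  sumW-*ˡ zero    x φ = ≈refl
  sumW-*ˡ (suc d) x φ = ≈trans (sum-cong-≋ (λ a → sumW-*ˡ d x (λ w → φ (a ∷ w))))
    (≈sym (*-distribˡ-sum x (λ a → sumW d (λ w → φ (a ∷ w)))))

  sumW-0 : ∀ d {φ : Word d → Carrier} → (∀ w → φ w ≈ 0#) → sumW d φ ≈ 0#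
  sumW-0 zero    e = e []
  sumW-0 (suc d) e = sum-0 (λ a → sumW-0 d (λ w → e (a ∷ w)))

  sum-digits : ∀ d (φ : Word d → Carrier) → sum (λ i → φ (digits d i)) ≈ sumW d φ
  sum-digits zero    φ = +-identityʳ (φ [])
  sum-digits (suc d) φ = begin
    sum (λ i → φ (digits (suc d) i))
      ≈⟨ sum-* B (B ^ d) (λ i → φ (digits (suc d) i)) ⟩
    sum {B} (λ a → sum {B ^ d} (λ i → φ (digits (suc d) (combine a i))))
      ≈⟨ sum-cong-≋ (λ a → sum-cong-≋ (λ i → reflexive (≡.cong φ (digits-combine d a i)))) ⟩
    sum {B} (λ a → sum {B ^ d} (λ i → φ (a ∷ digits d i)))
      ≈⟨ sum-cong-≋ (λ a → sum-digits d (λ w → φ (a ∷ w))) ⟩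
    sumW (suc d) φ ∎

  -- Kronecker's delta, defined with the comparison that the program makes, so that the weights of
  -- the system reduce to it by cases on the same Boolean.
  δ : ∀ {d} → Word d → Word d → Carrier
  δ u w = if eqs (Vec.map toℕ w) (Vec.map toℕ u) then 1# else 0#

  sumW-δ : ∀ {d} (u : Word d) (φ : Word d → Carrier) → sumW d (λ w → δ u w * φ w) ≈ φ u
  sumW-δ {zero}  []      φ = *-identityˡ (φ [])
  sumW-δ {suc d} (b ∷ u) φ = begin
    sum (λ a → sumW d (λ w → δ (b ∷ u) (a ∷ w) * φ (a ∷ w)))
      ≈⟨ sum-only (λ a → sumW d (λ w → δ (b ∷ u) (a ∷ w) * φ (a ∷ w))) b
           (λ a a≢b → sumW-0 d λ w → ≈trans (*-congʳ (reflexive (≡.cong (λ t →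
             if t ∧ eqs (Vec.map toℕ w) (Vec.map toℕ u) then 1# else 0#)
             (dec-false (toℕ a ℕ.≟ toℕ b) (a≢b ∘ toℕ-injective))))) (zeroˡ (φ (a ∷ w)))) ⟩
    sumW d (λ w → δ (b ∷ u) (b ∷ w) * φ (b ∷ w))
      ≈⟨ sumW-cong d (λ w → *-congʳ (reflexive (≡.cong (λ t →
             if t ∧ eqs (Vec.map toℕ w) (Vec.map toℕ u) then 1# else 0#)
             (dec-true (toℕ b ℕ.≟ toℕ b) ≡.refl)))) ⟩
    sumW d (λ w → δ u w * φ (b ∷ w))
      ≈⟨ sumW-δ u (λ w → φ (b ∷ w)) ⟩
    φ (b ∷ u) ∎

-- Solutions and matrices of low rank in the subspace.

module Correctness {c ℓ} (F : FiniteField c ℓ) (k : ℕ) {n r} (f : Over.QuadEq F n r) where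

  open Machine
  open Encoding
  open FiniteField F hiding (zero) renaming (refl to ≈refl; sym to ≈sym; trans to ≈trans)
  open Over F
  open FieldLemmas F
  open LowRank F
  open Reduction F k hiding (Word)
  open WordSums F (suc n)
  open import Algebra.Properties.Ring ring using (-1*x≈-x)
  open import Algebra.Properties.Group +-group using () renaming (x∙y⁻¹≈ε⇒x≈y to x-y≈0⇒x≈y)
  open import Algebra.Properties.Semiring.Sum semiring
  open import Algebra.Properties.CommutativeSemigroup *-commutativeSemigroup using (x∙yz≈y∙xz)
  open import Data.Bool using (true; false; if_then_else_)
  open import Data.Fin using (Fin; zero; suc; toℕ; combine; splitAt; quotient; remainder; _↑ˡ_; _↑ʳ_; fromℕ<)
  open import Data.Fin.Properties as Fin using (remQuot-combine; splitAt-↑ˡ; splitAt-↑ʳ; toℕ-fromℕ<)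
  open import Data.List using (List; []; _∷_; _++_; length; replicate)
  open import Data.List.Properties using (++-assoc; length-++; length-replicate)
  open import Data.List.Relation.Binary.Permutation.Propositional using (_↭_; refl; prep; swap; trans; ↭-reflexive)
  open import Data.List.Relation.Binary.Permutation.Propositional.Properties using (↭-length; ++-comm; ++⁺ˡ)
  open import Data.Nat as ℕ using (zero; suc; _≤_; _<_; _∸_; z≤n; s≤s)
  import Data.Nat.Properties as ℕ
  open import Data.Product using (∃-syntax; _×_; _,_; proj₁; proj₂)
  open import Data.Sum using (inj₁; inj₂)
  open import Data.Vec as Vec using (Vec; []; _∷_)
  open import Data.Vec.Properties using (length-toList; take++drop≡id)
  open import Function using (_∘_)
  open import Relation.Binary.PropositionalEquality as ≡ using (_≡_; _≢_)
  open import Relation.Binary.Reasoning.Setoid setoid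
  open import Relation.Nullary using (¬_; yes; no; contradiction)

  -- The matrix X as a functional on words of length M = D + D.
  ⟦_⟧ : Matrix (N f) (N f) → Word M → Carrier
  ⟦ X ⟧ w = X (index (Vec.take D w)) (index (Vec.drop D w))

  take-++ : ∀ {A : Set} {d e} (u : Vec A d) (v : Vec A e) → Vec.take d (u Vec.++ v) ≡ u
  take-++ []      v = ≡.refl
  take-++ (x ∷ u) v = ≡.cong (x ∷_) (take-++ u v)

  drop-++ : ∀ {A : Set} {d e} (u : Vec A d) (v : Vec A e) → Vec.drop d (u Vec.++ v) ≡ v
  drop-++ []      v = ≡.refl
  drop-++ (x ∷ u) v = drop-++ u v

  ⟦⟧-++ : ∀ X (u v : Word D) → ⟦ X ⟧ (u Vec.++ v) ≡ X (index u) (index v)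
  ⟦⟧-++ X u v = ≡.cong₂ (λ x y → X (index x) (index y)) (take-++ u v) (drop-++ u v)

  ⟪⟫-words : ∀ (K : Word M → Carrier) X →
             ⟪ (λ i j → K (digits D i Vec.++ digits D j)) , X ⟫ ≈ sumW M (λ w → K w * ⟦ X ⟧ w)
  ⟪⟫-words K X = begin
    sum {N f} (λ i → sum {N f} (λ j → K (digits D i Vec.++ digits D j) * X i j))
      ≈⟨ sum-cong-≋ {N f} (λ i → sum-cong-≋ {N f} (λ j → *-congˡ (reflexive (≡.sym (≡.trans
           (⟦⟧-++ X (digits D i) (digits D j)) (≡.cong₂ X (index-digits D i) (index-digits D j))))))) ⟩
    sum {N f} (λ i → sum {N f} (λ j → κ (digits D i Vec.++ digits D j)))
      ≈⟨ sum-cong-≋ {N f} (λ i → sum-digits D (λ v → κ (digits D i Vec.++ v))) ⟩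
    sum {N f} (λ i → sumW D (λ v → κ (digits D i Vec.++ v)))
      ≈⟨ sum-digits D (λ u → sumW D (λ v → κ (u Vec.++ v))) ⟩
    sumW D (λ u → sumW D (λ v → κ (u Vec.++ v)))
      ≈⟨ sumW-++ D κ ⟨
    sumW M κ ∎
    where
      κ : Word M → Carrier
      κ w = K w * ⟦ X ⟧ w

  signed-δ : ∀ {d} (u v w : Word d) → signed f u v w ≈ δ u w + - 1# * δ v w
  signed-δ u v w with same f w u | same f w v
  ... | true  | true  = ≈sym (≈trans (+-congˡ (*-identityʳ (- 1#))) (-‿inverseʳ 1#))
  ... | true  | false = ≈sym (≈trans (+-congˡ (zeroʳ (- 1#))) (+-identityʳ 1#))
  ... | false | true  = ≈sym (≈trans (+-identityˡ _) (*-identityʳ (- 1#)))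
  ... | false | false = ≈sym (≈trans (+-identityˡ _) (zeroʳ (- 1#)))

  sum-signed : ∀ {d} (u v : Word d) φ → sumW d (λ w → signed f u v w * φ w) ≈ φ u + - φ v
  sum-signed {d} u v φ = begin
    sumW d (λ w → signed f u v w * φ w)
      ≈⟨ sumW-cong d (λ w → ≈trans (*-congʳ (signed-δ u v w))
           (≈trans (distribʳ (φ w) (δ u w) (- 1# * δ v w)) (+-congˡ (*-assoc (- 1#) (δ v w) (φ w))))) ⟩
    sumW d (λ w → δ u w * φ w + - 1# * (δ v w * φ w))
      ≈⟨ sumW-+ d (λ w → δ u w * φ w) (λ w → - 1# * (δ v w * φ w)) ⟩
    sumW d (λ w → δ u w * φ w) + sumW d (λ w → - 1# * (δ v w * φ w))
      ≈⟨ +-cong (sumW-δ u φ) (sumW-*ˡ d (- 1#) (λ w → δ v w * φ w)) ⟩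
    φ u + - 1# * sumW d (λ w → δ v w * φ w)
      ≈⟨ +-congˡ (≈trans (*-congˡ (sumW-δ v φ)) (-1*x≈-x (φ v))) ⟩
    φ u + - φ v ∎

  sum-monomial-coeff : ∀ p (E : Fin (suc n) → Fin (suc n) → Carrier) →
               sum (λ a → sum (λ b → monomial-coeff f p a b * E a b)) ≈ apply p E
  sum-monomial-coeff p E = +-congˡ (sum-cong-≋ λ i → ≈trans (+-congʳ (zeroˡ (E (suc i) zero))) (+-identityˡ _))

  sum-located : ∀ {d} p x y (u : Word d) (φ : Word (2 ℕ.+ d) → Carrier) →
                sumW (2 ℕ.+ d) (λ w → located f p (x ∷ y ∷ u) w * φ w) ≈ apply p (λ a b → φ (a ∷ b ∷ u))
  sum-located {d} p x y u φ = begin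
      sumW (2 ℕ.+ d) (λ w → located f p (x ∷ y ∷ u) w * φ w)
        ≈⟨ sum-cong-≋ (λ a → sum-cong-≋ (λ b → inner a b)) ⟩
      sum (λ a → sum (λ b → monomial-coeff f p a b * φ (a ∷ b ∷ u)))
        ≈⟨ sum-monomial-coeff p (λ a b → φ (a ∷ b ∷ u)) ⟩
      apply p (λ a b → φ (a ∷ b ∷ u)) ∎
    where
      scale : ∀ w a b → (if same f w u then monomial-coeff f p a b else 0#) ≈ monomial-coeff f p a b * δ u w
      scale w a b with same f w u
      ... | true  = ≈sym (*-identityʳ _)
      ... | false = ≈sym (zeroʳ _)
      inner : ∀ a b → sumW d (λ w → located f p (x ∷ y ∷ u) (a ∷ b ∷ w) * φ (a ∷ b ∷ w)) ≈ monomial-coeff f p a b * φ (a ∷ b ∷ u)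
      inner a b = begin
        sumW d (λ w → (if same f w u then monomial-coeff f p a b else 0#) * φ (a ∷ b ∷ w))
          ≈⟨ sumW-cong d (λ w → ≈trans (*-congʳ (scale w a b)) (*-assoc _ _ _)) ⟩
        sumW d (λ w → monomial-coeff f p a b * (δ u w * φ (a ∷ b ∷ w)))
          ≈⟨ sumW-*ˡ d (monomial-coeff f p a b) (λ w → δ u w * φ (a ∷ b ∷ w)) ⟩
        monomial-coeff f p a b * sumW d (λ w → δ u w * φ (a ∷ b ∷ w))
          ≈⟨ *-congˡ (sumW-δ u (λ w → φ (a ∷ b ∷ w))) ⟩
        monomial-coeff f p a b * φ (a ∷ b ∷ u) ∎

  Satisfies : Family f → Word M → Matrix (N f) (N f) → Set ℓ
  Satisfies φ u X = sumW M (λ w → weight f φ u w * ⟦ X ⟧ w) ≈ 0#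

  member⇒ : ∀ X → X ∈ₛ solutionSpace (system f) → ∀ φ u → Satisfies (splitAt (suc M) φ) u X
  member⇒ X X∈ φ u = ≈trans (≈sym (⟪⟫-words (weight f (splitAt (suc M) φ) u) X))
    (≡.subst (λ (φ , u) → ⟪ (λ i j → weight f (splitAt (suc M) φ) u (digits D i Vec.++ digits D j)) , X ⟫ ≈ 0#)
      (≡.cong₂ _,_ (≡.cong proj₁ e) (≡.trans (≡.cong (digits M ∘ proj₂) e) (digits-index u)))
      (X∈ (combine φ (index u))))
    where
      e = remQuot-combine {suc M ℕ.+ r} φ (index u)

  ⇒member : ∀ X → (∀ φ u → Satisfies φ u X) → X ∈ₛ solutionSpace (system f)
  ⇒member X h e = ≈trans (⟪⟫-words (weight f φ u) X) (h φ u)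
    where
      φ = splitAt (suc M) (quotient {suc M ℕ.+ r} (suc n ℕ.^ M) e)
      u = digits M (remainder {suc M ℕ.+ r} (suc n ℕ.^ M) e)

  module Yes (x : Fin n → Carrier) (boolean : Boolean x) (solves : ∀ s → eval (f s) x ≈ 0#) where

    val : Fin (suc n) → Carrier
    val zero    = 1#
    val (suc i) = x i

    χ : ∀ {d} → Word d → Carrier
    χ []      = 1#
    χ (a ∷ w) = val a * χ w

    X : Matrix (N f) (N f)
    X i j = χ (digits D i) * χ (digits D j)

    χ-++ : ∀ {d d′} (u : Word d) (v : Word d′) → χ (u Vec.++ v) ≈ χ u * χ v
    χ-++ []      v = ≈sym (*-identityˡ (χ v))
    χ-++ (a ∷ u) v = ≈trans (*-congˡ (χ-++ u v)) (≈sym (*-assoc (val a) (χ u) (χ v)))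

    ⟦X⟧ : ∀ w → ⟦ X ⟧ w ≈ χ w
    ⟦X⟧ w = begin
      χ (digits D (index (Vec.take D w))) * χ (digits D (index (Vec.drop D w)))
        ≡⟨ ≡.cong₂ (λ u v → χ u * χ v) (digits-index (Vec.take D w)) (digits-index (Vec.drop D w)) ⟩
      χ (Vec.take D w) * χ (Vec.drop D w)       ≈⟨ χ-++ (Vec.take D w) (Vec.drop D w) ⟨
      χ (Vec.take D w Vec.++ Vec.drop D w)      ≡⟨ ≡.cong χ (take++drop≡id D w) ⟩
      χ w                                       ∎

    val-idem : ∀ a → val a * val a ≈ val a
    val-idem zero    = *-identityˡ 1#
    val-idem (suc i) with boolean i
    ... | inj₁ z = ≈trans (*-congˡ z) (≈trans (zeroʳ (x i)) (≈sym z))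
    ... | inj₂ o = ≈trans (*-congˡ o) (*-identityʳ (x i))

    χ-swapAt : ∀ {d} p (w : Word d) → χ w ≈ χ (swapAt p w)
    χ-swapAt zero    []          = ≈refl
    χ-swapAt zero    (a ∷ [])    = ≈refl
    χ-swapAt zero    (a ∷ b ∷ w) = x∙yz≈y∙xz (val a) (val b) (χ w)
    χ-swapAt (suc p) []          = ≈refl
    χ-swapAt (suc p) (a ∷ w)     = *-congˡ (χ-swapAt p w)

    χ-template : ∀ t (u : Word M) → χ (lhs {t = M} t zero u) ≈ χ (rhs {t = M} t zero u)
    χ-template zero    (a ∷ b ∷ w) = begin
      val a * (val a * χ w) ≈⟨ *-assoc (val a) (val a) (χ w) ⟨
      val a * val a * χ w   ≈⟨ *-congʳ (val-idem a) ⟩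
      val a * χ w           ≈⟨ *-congˡ (*-identityˡ (χ w)) ⟨
      val a * (1# * χ w)    ∎
    χ-template (suc p) w = χ-swapAt (toℕ p) w

    satisfies : ∀ φ u → Satisfies φ u X
    satisfies (inj₁ t) u = begin
      sumW M (λ w → signed f (lhs t zero u) (rhs t zero u) w * ⟦ X ⟧ w)
        ≈⟨ sum-signed (lhs t zero u) (rhs t zero u) ⟦ X ⟧ ⟩
      ⟦ X ⟧ (lhs t zero u) + - ⟦ X ⟧ (rhs t zero u)
        ≈⟨ +-congʳ (≈trans (⟦X⟧ (lhs t zero u)) (≈trans (χ-template t u) (≈sym (⟦X⟧ (rhs t zero u))))) ⟩
      ⟦ X ⟧ (rhs t zero u) + - ⟦ X ⟧ (rhs t zero u)
        ≈⟨ -‿inverseʳ _ ⟩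
      0# ∎
    satisfies (inj₂ s) (a ∷ b ∷ u) = begin
      sumW M (λ w → located f (f s) (a ∷ b ∷ u) w * ⟦ X ⟧ w)
        ≈⟨ sum-located {m} (f s) a b u ⟦ X ⟧ ⟩
      apply (f s) (λ a b → ⟦ X ⟧ (a ∷ b ∷ u))
        ≈⟨ apply-cong (f s) (λ a b → ⟦X⟧ (a ∷ b ∷ u)) ⟩
      apply (f s) (λ a b → val a * (val b * χ u))
        ≈⟨ apply-eval (f s) val (χ u) ≈refl ⟩
      eval (f s) x * χ u
        ≈⟨ *-congʳ (solves s) ⟩
      0# * χ u
        ≈⟨ zeroˡ (χ u) ⟩
      0# ∎

    -- The monomial 1, whose value is 1 at every point. It shows at once that `X` is nonzero, that
    -- the vector of evaluations is independent, and that this vector is itself a column of `X`.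
    one : Fin (N f)
    one = index (Vec.replicate D zero)

    χ-one : χ (digits D one) ≈ 1#
    χ-one = ≈trans (reflexive (≡.cong χ (digits-index (Vec.replicate D zero)))) (ones D)
      where
        ones : ∀ d → χ (Vec.replicate d zero) ≈ 1#
        ones zero    = ≈refl
        ones (suc d) = ≈trans (*-identityˡ _) (ones d)

    X-nonzero : Nonzero X
    X-nonzero X≈0 = 0≉1 (begin
      0#                                   ≈⟨ X≈0 one one ⟨
      χ (digits D one) * χ (digits D one)  ≈⟨ *-cong χ-one χ-one ⟩
      1# * 1#                              ≈⟨ *-identityˡ 1# ⟩
      1#                                   ∎)

    X-rank : HasRank X 1
    X-rank = (λ _ i → χ (digits D i))
      , (λ { a z zero → begin
            a zero                             ≈⟨ *-identityʳ (a zero) ⟨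
            a zero * 1#                        ≈⟨ *-congˡ χ-one ⟨
            a zero * χ (digits D one)          ≈⟨ +-identityʳ _ ⟨
            a zero * χ (digits D one) + 0#     ≈⟨ z one ⟩
            0#                                 ∎ })
      , (λ _ → (λ j → indicator j) , λ i → ≈sym (begin
            sum (λ j → indicator j * (χ (digits D i) * χ (digits D j)))
              ≈⟨ sum-only (λ j → indicator j * (χ (digits D i) * χ (digits D j))) one
                   (λ j j≢one → ≈trans (*-congʳ (off j j≢one)) (zeroˡ _)) ⟩
            indicator one * (χ (digits D i) * χ (digits D one))
              ≈⟨ *-cong on (≈trans (*-congˡ χ-one) (*-identityʳ _)) ⟩
            1# * χ (digits D i)
              ≈⟨ *-identityˡ _ ⟩
            χ (digits D i) ∎))
      , (λ j → (λ _ → χ (digits D j)) , λ i → ≈trans (*-comm _ _) (≈sym (+-identityʳ _)))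
      where
        indicator : Fin (N f) → Carrier
        indicator j with j Fin.≟ one
        ... | yes _ = 1#
        ... | no  _ = 0#
        on : indicator one ≈ 1#
        on with one Fin.≟ one
        ... | yes _ = ≈refl
        ... | no ¬p = contradiction ≡.refl ¬p
        off : ∀ j → j ≢ one → indicator j ≈ 0#
        off j j≢one with j Fin.≟ one
        ... | yes p = contradiction p j≢one
        ... | no  _ = ≈refl

    yes-case : ∃[ X ] X ∈ₛ solutionSpace (system f) × Nonzero X × HasRank X 1
    yes-case = X , ⇒member X satisfies , X-nonzero , X-rank

  -- The trailing letters stand for factors 1, so the monomial stays the same. Lists longer than `d`
  -- are cut off; the degree bounds in `PseudoSolution` keep them out.
  pad : ∀ d → List (Fin (suc n)) → Word d
  pad zero    w       = []
  pad (suc d) []      = zero ∷ pad d []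
  pad (suc d) (a ∷ w) = a ∷ pad d w

  pad-zeros : ∀ d w e → pad d (w ++ replicate e zero) ≡ pad d w
  pad-zeros zero    w       e       = ≡.refl
  pad-zeros (suc d) []      zero    = ≡.refl
  pad-zeros (suc d) []      (suc e) = ≡.cong (zero ∷_) (pad-zeros d [] e)
  pad-zeros (suc d) (a ∷ w) e       = ≡.cong (a ∷_) (pad-zeros d w e)

  pad-++ : ∀ d e u v → length u ≤ d → pad d u Vec.++ pad e v ≡ pad (d ℕ.+ e) (u ++ replicate (d ∸ length u) zero ++ v)
  pad-++ zero    e []      v l       = ≡.refl
  pad-++ (suc d) e []      v l       = ≡.cong (zero ∷_) (pad-++ d e [] v z≤n)
  pad-++ (suc d) e (a ∷ u) v (s≤s l) = ≡.cong (a ∷_) (pad-++ d e u v l)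

  pad-swap : ∀ d u a b v → 2 ℕ.+ length u ≤ d → pad d (u ++ b ∷ a ∷ v) ≡ swapAt (length u) (pad d (u ++ a ∷ b ∷ v))
  pad-swap (suc (suc d)) []      a b v l       = ≡.refl
  pad-swap (suc d)       (x ∷ u) a b v (s≤s l) = ≡.cong (x ∷_) (pad-swap d u a b v l)

  pad-toList : ∀ {d} (w : Word d) → pad d (Vec.toList w) ≡ w
  pad-toList []      = ≡.refl
  pad-toList (a ∷ w) = ≡.cong (a ∷_) (pad-toList w)

  module No (X : Matrix (N f) (N f)) (X∈ : X ∈ₛ solutionSpace (system f)) where

    L : List (Fin (suc n)) → Carrier
    L w = ⟦ X ⟧ (pad M w)

    template-rule : ∀ t u → ⟦ X ⟧ (lhs {t = M} t zero u) ≈ ⟦ X ⟧ (rhs {t = M} t zero u)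
    template-rule t u = x-y≈0⇒x≈y _ _ (≈trans (≈sym (sum-signed (lhs t zero u) (rhs t zero u) ⟦ X ⟧))
      (≡.subst (λ φ → Satisfies φ u X) (splitAt-↑ˡ (suc M) t r) (member⇒ X X∈ (t ↑ˡ r) u)))

    polynomial-rule : ∀ s u → apply (f s) (λ a b → ⟦ X ⟧ (a ∷ b ∷ u)) ≈ 0#
    polynomial-rule s u = ≈trans (≈sym (sum-located {m} (f s) zero zero u ⟦ X ⟧))
      (≡.subst (λ φ → Satisfies φ (zero ∷ zero ∷ u) X) (splitAt-↑ʳ (suc M) r s)
        (member⇒ X X∈ (suc M ↑ʳ s) (zero ∷ zero ∷ u)))

    L-swap : ∀ u a b v → 2 ℕ.+ length u ≤ M → L (u ++ a ∷ b ∷ v) ≈ L (u ++ b ∷ a ∷ v)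
    L-swap u a b v l = ≈trans (template-rule (suc (fromℕ< |u|<M)) (pad M (u ++ a ∷ b ∷ v)))
        (reflexive (≡.cong ⟦ X ⟧ (≡.trans
          (≡.cong (λ p → swapAt p (pad M (u ++ a ∷ b ∷ v))) (toℕ-fromℕ< |u|<M))
          (≡.sym (pad-swap M u a b v l)))))
      where
        |u|<M : length u < M
        |u|<M = ℕ.<-trans (ℕ.n<1+n (length u)) l

    -- The prefix `p` collects the letters already passed: the recursion descends into the
    -- permutation, whereas the swap equation refers to a position in the whole word.
    L-↭ : ∀ p {u v} → length (p ++ u) ≤ M → u ↭ v → L (p ++ u) ≈ L (p ++ v)
    L-↭ p l refl = ≈refl
    L-↭ p {x ∷ u} {_ ∷ v} l (prep x π) = begin
      L (p ++ x ∷ u)          ≡⟨ ≡.cong L (++-assoc p (x ∷ []) u) ⟨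
      L ((p ++ x ∷ []) ++ u)  ≈⟨ L-↭ (p ++ x ∷ []) (≡.subst (λ w → length w ≤ M) (≡.sym (++-assoc p (x ∷ []) u)) l) π ⟩
      L ((p ++ x ∷ []) ++ v)  ≡⟨ ≡.cong L (++-assoc p (x ∷ []) v) ⟩
      L (p ++ x ∷ v)          ∎
    L-↭ p {x ∷ y ∷ u} {_ ∷ _ ∷ v} l (swap x y π) = begin
      L (p ++ x ∷ y ∷ u)          ≈⟨ L-swap p x y u (ℕ.≤-trans short l) ⟩
      L (p ++ y ∷ x ∷ u)          ≡⟨ ≡.cong L (++-assoc p (y ∷ x ∷ []) u) ⟨
      L ((p ++ y ∷ x ∷ []) ++ u)  ≈⟨ L-↭ (p ++ y ∷ x ∷ []) (≡.subst (_≤ M) same-length l) π ⟩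
      L ((p ++ y ∷ x ∷ []) ++ v)  ≡⟨ ≡.cong L (++-assoc p (y ∷ x ∷ []) v) ⟩
      L (p ++ y ∷ x ∷ v)          ∎
      where
        same-length : length (p ++ x ∷ y ∷ u) ≡ length ((p ++ y ∷ x ∷ []) ++ u)
        same-length = ≡.trans (length-++ p) (≡.trans (≡.sym (length-++ p)) (≡.cong length (≡.sym (++-assoc p (y ∷ x ∷ []) u))))
        short : 2 ℕ.+ length p ≤ length (p ++ x ∷ y ∷ u)
        short = ≡.subst₂ _≤_ (ℕ.+-comm (length p) 2) (≡.sym (length-++ p))
          (ℕ.+-monoʳ-≤ (length p) (s≤s (s≤s z≤n)))
    L-↭ p l (trans π ρ) = ≈trans (L-↭ p l π)
      (L-↭ p (≡.subst (_≤ M) (↭-length (++⁺ˡ p π)) l) ρ)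

    L-zeros : ∀ w e → L (w ++ replicate e zero) ≈ L w
    L-zeros w e = reflexive (≡.cong ⟦ X ⟧ (pad-zeros M w e))

    -- No equation of the system says this directly: symmetry moves the letter `zero` to the end,
    -- where it becomes part of the padding.
    L-unit : ∀ w → 1 ℕ.+ length w ≤ M → L (zero ∷ w) ≈ L w
    L-unit w l = ≈trans (L-↭ [] l (++-comm (zero ∷ []) w)) (L-zeros w 1)

    L-idem : Idempotent M L
    L-idem a w l = begin
      L (a ∷ a ∷ w)     ≈⟨ template-rule zero (pad M (a ∷ a ∷ w)) ⟩
      L (a ∷ zero ∷ w)  ≈⟨ L-swap [] a zero w (s≤s (s≤s z≤n)) ⟩
      L (zero ∷ a ∷ w)  ≈⟨ L-unit (a ∷ w) l ⟩
      L (a ∷ w)         ∎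

    -- In the entry of `X` the padding of `u` stands between `u` and `v`. Symmetry moves it to the
    -- end, where `pad` absorbs it.
    L-product : ∀ u v → length u ≤ D → length v ≤ D → L (u ++ v) ≈ X (index (pad D u)) (index (pad D v))
    L-product u v lu lv = begin
      L (u ++ v)                        ≈⟨ L-zeros (u ++ v) e ⟨
      L ((u ++ v) ++ replicate e zero)  ≈⟨ L-↭ [] l π ⟩
      L (u ++ replicate e zero ++ v)    ≡⟨ ≡.cong ⟦ X ⟧ (pad-++ D D u v lu) ⟨
      ⟦ X ⟧ (pad D u Vec.++ pad D v)    ≡⟨ ⟦⟧-++ X (pad D u) (pad D v) ⟩
      X (index (pad D u)) (index (pad D v)) ∎
      where
        e = D ∸ length u
        π : (u ++ v) ++ replicate e zero ↭ u ++ replicate e zero ++ v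
        π = trans (↭-reflexive (++-assoc u v (replicate e zero))) (++⁺ˡ u (++-comm v (replicate e zero)))
        l : length ((u ++ v) ++ replicate e zero) ≤ M
        l = ≡.subst (_≤ M) (≡.sym (≡.trans (↭-length π) (≡.trans (length-++ u) (≡.trans
              (≡.cong (length u ℕ.+_) (≡.trans (length-++ (replicate e zero))
                (≡.cong (ℕ._+ length v) (length-replicate e))))
              (≡.trans (≡.sym (ℕ.+-assoc (length u) e (length v)))
                (≡.cong (ℕ._+ length v) (ℕ.m+[n∸m]≡n lu)))))))
            (ℕ.+-monoʳ-≤ D lv)

    -- A rank factorization of `X`: the basis of the column space gives `B`, and the coordinates of
    -- the columns in it give `C`.
    pseudoSolution : ∀ {ρ} → HasRank X ρ → PseudoSolution f D ρ
    pseudoSolution (basis , _ , _ , spanned) = record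
      { L          = L
      ; symmetric  = L-↭ []
      ; idempotent = L-idem
      ; unit       = L-unit
      -- As `M` is `2 + m`, `pad M (a ∷ b ∷ w)` computes to `a ∷ b ∷ pad m w`.
      ; annihilate = λ s w l → polynomial-rule s (pad m w)
      ; B          = λ s u → basis s (index (pad D u))
      ; C          = λ s v → proj₁ (spanned (index (pad D v))) s
      ; factor     = λ u v lu lv → ≈trans (L-product u v lu lv)
          (≈trans (proj₂ (spanned (index (pad D v))) (index (pad D u))) (sum-cong-≋ λ s →
            *-comm (proj₁ (spanned (index (pad D v))) s) (basis s (index (pad D u)))))
      }

    no-case : ¬ Satisfiable f → ∀ {ρ} → ρ ≤ k → HasRank X ρ → ¬ Nonzero X
    no-case unsat ρ≤k rank nonzero = nonzero λ i j → begin
      X i j                                           ≡⟨ ≡.cong₂ X (index-digits D i) (index-digits D j) ⟨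
      X (index (digits D i)) (index (digits D j))     ≡⟨ ⟦⟧-++ X (digits D i) (digits D j) ⟨
      ⟦ X ⟧ (digits D i Vec.++ digits D j)            ≡⟨ ≡.cong ⟦ X ⟧ (pad-toList (digits D i Vec.++ digits D j)) ⟨
      L (Vec.toList (digits D i Vec.++ digits D j))   ≈⟨ Vanishing.vanish {f = f} unsat ρ≤k (ℕ.m≤n+m _ 2) (pseudoSolution rank)
                                                             (Vec.toList (digits D i Vec.++ digits D j))
                                                           (ℕ.≤-reflexive (length-toList (digits D i Vec.++ digits D j))) ⟩
      0#                                              ∎

open import Data.Nat using (_≤_; _*_; _^_)
open import Data.Product using (Σ; ∃-syntax; _×_; _,_)
open import Relation.Nullary using (¬_)

theorem4p2 : ∀ {c ℓ : Level} (F : FiniteField c ℓ) → let open Over F in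
    ∃[ C ] ∀ (k : ℕ) → 1 ≤ k →
    Σ Program λ P → ∀ (n m : ℕ) (f : QuadEq n m) →
    Σ ℕ λ N → Σ (LinearSystem N) λ E → Σ ℕ λ t →
    Computes P (encodeInstance f) (encodeSystem E) t
    × (2 ≤ n → t ≤ suc m * n ^ (C * k))
    × (2 ≤ n → N ≤ n ^ (C * k))
    × (Satisfiable f →
    ∃[ X ] X ∈ₛ solutionSpace E × Nonzero X × HasRank X 1)
    × (¬ Satisfiable f →
    ¬ (∃[ X ] X ∈ₛ solutionSpace E × Nonzero X × ∃[ r ] r ≤ k × HasRank X r))
theorem4p2 F = 300 , λ k 1≤k → program k , λ n m f →
    let (t , computed , t≤) = computes k f
    in N k f , system k f , t , computed
     , (λ 2≤n → t≤ 2≤n 1≤k)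
     , (λ 2≤n → Time.size-bound {n} {k} 2≤n 1≤k)
     , (λ (x , boolean , solves) → Correctness.Yes.yes-case F k f x boolean solves)
     , (λ unsat (X , X∈ , nonzero , r , r≤k , rank) → Correctness.No.no-case F k f X X∈ unsat r≤k rank nonzero)
  where open Reduction F
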